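{- For each positive integer $p$ there exists a polynomial $P_p$ such that for every finite loopless multigraph $G$, $$\Big(\widetilde\nabla^{\rm m}_{(p-1)/2}(G)\Big)^{1/p}\le {\rm Arb}_p(G)\le P_p\Big(\widetilde\nabla^{\rm m}_{(p-1)/2}(G)\Big).$$
   Context: All multigraphs are finite and loopless; cycles include $2$-cycles formed by two parallel edges, and $|C|$ is the number of edges of a cycle $C$. ${\rm Arb}_p(G)$ is the minimum number of colours in an edge colouring of $G$ such that every cycle $C$ of $G$ receives at least $\min(|C|,p+1)$ distinct colours. For a half-integer $r\ge0$, $\widetilde\nabla^{\rm m}_r(G)$ is the maximum of $\|H\|/|H|$ over all loopless multigraphs $H$ such that some $\le 2r$-subdivision of $H$ (each edge, each parallel copy separately, replaced by a path with at most $2r$ internal vertices, the paths internally disjoint) is a subgraph of $G$; $\|H\|$ counts edges with multiplicity and $|H|$ is the number of vertices. -}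

module Defs where

open import Data.Fin as Fin using (Fin; zero; suc; toℕ; fromℕ<; finToFun; funToFin; join; splitAt)
open import Data.Fin.Properties as Fin using (all?; any?; toℕ-fromℕ<; toℕ<n; finToFun-funToFin; splitAt-join; injective⇒≤)
open import Data.Integer using (+_)
open import Data.List using (List; length; tabulate; deduplicate; foldr; filter; upTo; cartesianProduct; _∷_)
import Data.List.Extrema as Extrema
open import Data.List.Membership.Propositional.Properties using (∈-filter⁺; ∈-cartesianProduct⁺; ∈-upTo⁺)
open import Data.List.Properties using (tabulate-cong; length-tabulate; filter-all)
import Data.List.Relation.Unary.All as All
open import Data.List.Relation.Unary.All.Properties using (all-filter)
open import Data.List.Relation.Unary.AllPairs using ([]; _∷_)
open import Data.List.Relation.Unary.Unique.Propositional using (Unique)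
open import Data.List.Relation.Unary.Unique.Propositional.Properties using (tabulate⁺)
open import Data.Nat as ℕ using (ℕ; zero; suc; _⊓_; _≤_; _<_; s≤s; s≤s⁻¹)
open import Data.Nat.Induction using (<-rec)
import Data.Nat.Properties as ℕ
open import Data.Product using (Σ; ∃; ∃-syntax; _×_; _,_; proj₁; proj₂; swap; map)
import Data.Product.Properties as Product
open import Data.Rational as ℚ using (ℚ; 0ℚ; _/_)
import Data.Rational.Properties as ℚ
open import Data.Sum as Sum using (_⊎_; inj₁; inj₂)
open import Data.Sum.Properties using (inj₁-injective)
open import Data.Unit using (⊤; tt)
open import Data.Vec.Functional using () renaming (_∷_ to cons)
open import Function using (_∘_; id)
open import Function.Definitions using (Injective)
open import Relation.Binary.Bundles using (DecTotalOrder)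
open import Relation.Binary.PropositionalEquality using (_≡_; _≢_; _≗_; refl; sym; trans; cong; cong₂; subst)
open import Relation.Binary.PropositionalEquality.Properties using (subst-sym-subst)
open import Relation.Nullary using (Dec; yes; no; ¬_; ¬?; contradiction)
open import Relation.Nullary.Decidable using (map′; _×-dec_; _⊎-dec_; decidable-stable)

-- Each edge is stored with an arbitrary orientation, which no definition
-- below depends on.
record Graph : Set₁ where
  field
    V E  : Set
    ends : E → V × V

record Multigraph : Set where
  field
    order size : ℕ
    ends       : Fin size → Fin order × Fin order
    loopless   : ∀ e → proj₁ (ends e) ≢ proj₂ (ends e)

  graph : Graph
  graph = record { V = Fin order ; E = Fin size ; ends = ends }

open Multigraph public using (order; size; graph)

-- Copies of A as a (not necessarily induced) subgraph of B.
record _↪_ (A B : Graph) : Set where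
  private
    module A = Graph A
    module B = Graph B
  field
    onV       : A.V → B.V
    onE       : A.E → B.E
    injectV   : Injective _≡_ _≡_ onV
    injectE   : Injective _≡_ _≡_ onE
    incidence : ∀ e → B.ends (onE e) ≡ map onV onV (A.ends e)
                    ⊎ B.ends (onE e) ≡ swap (map onV onV (A.ends e))

open _↪_ public

infix 4 _↪_

snoc : {A : Set} {n : ℕ} → (Fin n → A) → A → Fin (suc n) → A
snoc {n = zero}  xs y zero    = y
snoc {n = suc _} xs y zero    = xs zero
snoc {n = suc _} xs y (suc i) = snoc (xs ∘ suc) y i

-- The cycle with k + 2 edges; edge i joins i to i + 1 modulo k + 2.
cycleGraph : ℕ → Graph
cycleGraph k = record
  { V    = Fin (2 ℕ.+ k)
  ; E    = Fin (2 ℕ.+ k)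
  ; ends = λ i → i , snoc suc zero i
  }

record Cycle (G : Multigraph) : Set where
  field
    excess : ℕ
    copy   : cycleGraph excess ↪ graph G

  len : ℕ
  len = 2 ℕ.+ excess

  edge : Fin len → Fin (size G)
  edge = onE copy

countDistinct : {n k : ℕ} → (Fin n → Fin k) → ℕ
countDistinct f = length (deduplicate Fin._≟_ (tabulate f))

ArbColouring : (p : ℕ) (G : Multigraph) {k : ℕ} → (Fin (size G) → Fin k) → Set
ArbColouring p G c = (C : Cycle G) → let open Cycle C in
  len ⊓ (p ℕ.+ 1) ≤ countDistinct (c ∘ edge)

ArbColourable : (p : ℕ) → Multigraph → ℕ → Set
ArbColourable p G k = Σ (Fin (size G) → Fin k) (ArbColouring p G)

record IsArb (p : ℕ) (G : Multigraph) (k : ℕ) : Set where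
  field
    colourable : ArbColourable p G k
    minimal    : ∀ j → ArbColourable p G j → k ≤ j

-- Edge e is replaced by a path through s e new vertices (e , 0), (e , 1), …;
-- the i-th of its s e + 1 edges joins the i-th entry of
-- u, (e , 0), (e , 1), …  to the i-th entry of  (e , 0), (e , 1), …, v.
subdivide : (H : Multigraph) → (Fin (size H) → ℕ) → Graph
subdivide H s = record
  { V    = Fin (order H) ⊎ Σ (Fin (size H)) (Fin ∘ s)
  ; E    = Σ (Fin (size H)) (λ e → Fin (suc (s e)))
  ; ends = λ (e , i) → let (u , v) = Multigraph.ends H e
                           new     = λ j → inj₂ (e , j)
                       in  cons (inj₁ u) new i , snoc new (inj₁ v) i
  }

-- Some ≤t-subdivision of H is a subgraph of G.
ShallowTopMinor : (t : ℕ) (H G : Multigraph) → Set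
ShallowTopMinor t H G =
  ∃[ s ] (∀ e → s e ≤ t) × (subdivide H s ↪ graph G)

-- The value 0 for the graph without vertices makes the maximum below
-- meaningful (and equal to 0) for a G without vertices; it is irrelevant for
-- all other G, where the one-vertex H already has density 0.
ratio : (vertices edges : ℕ) → ℚ
ratio zero      _ = 0ℚ
ratio n@(suc _) m = + m / n

density : Multigraph → ℚ
density H = ratio (order H) (size H)

-- The parameter t is twice the radius r.
record IsTopGrad (t : ℕ) (G : Multigraph) (q : ℚ) : Set where
  field
    attained : ∃[ H ] ShallowTopMinor t H G × density H ≡ q
    bound    : ∀ H → ShallowTopMinor t H G → density H ℚ.≤ q

-- Coefficients in order of increasing degree.
Polynomial : Set
Polynomial = List ℚ

eval : Polynomial → ℚ → ℚ
eval P x = foldr (λ a y → a ℚ.+ x ℚ.* y) 0ℚ P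

-- Exhaustive search, showing that the minimum and the maximum exist.
private

  record Enum (X : Set) : Set where
    field
      card  : ℕ
      index : X → Fin card
      elem  : Fin card → X
      retr  : ∀ x → elem (index x) ≡ x

  open Enum

  enumFin : ∀ n → Enum (Fin n)
  enumFin n = record { card = n ; index = id ; elem = id ; retr = λ _ → refl }

  enum⊎ : {X Y : Set} → Enum X → Enum Y → Enum (X ⊎ Y)
  enum⊎ {X} {Y} a b = record
    { card  = card a ℕ.+ card b
    ; index = join _ _ ∘ Sum.map (index a) (index b)
    ; elem  = Sum.map (elem a) (elem b) ∘ splitAt (card a)
    ; retr  = λ x → trans (cong (Sum.map (elem a) (elem b)) (splitAt-join _ _ (Sum.map (index a) (index b) x))) (r x)
    }
    where
    r : ∀ x → Sum.map (elem a) (elem b) (Sum.map (index a) (index b) x) ≡ x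
    r (inj₁ x) = cong inj₁ (retr a x)
    r (inj₂ y) = cong inj₂ (retr b y)

  enumΣ : ∀ {n} (s : Fin n → ℕ) → Enum (Σ (Fin n) (Fin ∘ s))
  enumΣ {zero}  s = record { card = 0 ; index = λ () ; elem = λ () ; retr = λ () }
  enumΣ {suc n} s = record
    { card  = card E
    ; index = index E ∘ to
    ; elem  = from ∘ elem E
    ; retr  = λ x → trans (cong from (retr E (to x))) (r x)
    }
    where
    E : Enum (Fin (s zero) ⊎ Σ (Fin n) (Fin ∘ s ∘ suc))
    E = enum⊎ (enumFin (s zero)) (enumΣ (s ∘ suc))
    to : Σ (Fin (suc n)) (Fin ∘ s) → Fin (s zero) ⊎ Σ (Fin n) (Fin ∘ s ∘ suc)
    to (zero  , i) = inj₁ i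
    to (suc e , i) = inj₂ (e , i)
    from : Fin (s zero) ⊎ Σ (Fin n) (Fin ∘ s ∘ suc) → Σ (Fin (suc n)) (Fin ∘ s)
    from (inj₁ i)       = zero , i
    from (inj₂ (e , i)) = suc e , i
    r : ∀ x → from (to x) ≡ x
    r (zero  , i) = refl
    r (suc e , i) = refl

  allOver : {X : Set} → Enum X → {P : X → Set} → (∀ x → Dec (P x)) → Dec (∀ x → P x)
  allOver a {P} P? = map′ (λ h x → subst P (retr a x) (h (index a x))) (λ h i → h (elem a i)) (all? (P? ∘ elem a))

  search : {X : Set} → Enum X → ∀ {n} {P : (X → Fin n) → Set} →
           (∀ {f g} → f ≗ g → P f → P g) → (∀ f → Dec (P f)) → Dec (∃ P)
  search a {n} {P} resp P? = map′ (λ (i , h) → fun i , h) back (any? (P? ∘ fun))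
    where
    fun : Fin (n ℕ.^ card a) → _ → Fin n
    fun i = finToFun i ∘ index a
    back : ∃ P → ∃ (P ∘ fun)
    back (f , h) = funToFin (f ∘ elem a) ,
      resp (λ x → sym (trans (finToFun-funToFin (f ∘ elem a) (index a x)) (cong f (retr a x)))) h

  Inj : {X Y : Set} → (X → Y) → Set
  Inj f = ∀ x y → f x ≡ f y → x ≡ y

  injective? : {X : Set} → Enum X → ∀ {n} (f : X → Fin n) → Dec (Inj f)
  injective? {X} a f = allOver a λ x → allOver a λ y → imp x y
    where
    eq? : (x y : X) → Dec (x ≡ y)
    eq? x y = map′ (λ e → trans (sym (retr a x)) (trans (cong (elem a) e) (retr a y))) (cong (index a)) (index a x Fin.≟ index a y)
    imp : (x y : X) → Dec (f x ≡ f y → x ≡ y)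
    imp x y with f x Fin.≟ f y | eq? x y
    ... | _     | yes e = yes λ _ → e
    ... | no ne | _     = yes λ e → contradiction e ne
    ... | yes e | no ne = no λ h → ne (h e)

  injResp : {X Y : Set} {f g : X → Y} → f ≗ g → Inj f → Inj g
  injResp f≗g inj x y e = inj x y (trans (f≗g x) (trans e (sym (f≗g y))))

  module _ (A : Graph) (a : Enum (Graph.V A)) (b : Enum (Graph.E A)) (G : Multigraph)
           {R : (Graph.E A → Fin (size G)) → Set}
           (respR : ∀ {f g} → f ≗ g → R f → R g) (R? : ∀ f → Dec (R f)) where

    private
      Inc : (Graph.V A → Fin (order G)) → (Graph.E A → Fin (size G)) → Graph.E A → Set
      Inc f g e = Multigraph.ends G (g e) ≡ map f f (Graph.ends A e)
                ⊎ Multigraph.ends G (g e) ≡ swap (map f f (Graph.ends A e))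

      Q : (Graph.V A → Fin (order G)) → (Graph.E A → Fin (size G)) → Set
      Q f g = Inj f × Inj g × (∀ e → Inc f g e) × R g

      incResp : ∀ {f f′ g g′} → f ≗ f′ → g ≗ g′ → ∀ e → Inc f g e → Inc f′ g′ e
      incResp {f} {f′} {g} {g′} p q e = Sum.map (λ h → trans l (trans h r)) (λ h → trans l (trans h (cong swap r)))
        where
        l : Multigraph.ends G (g′ e) ≡ Multigraph.ends G (g e)
        l = cong (Multigraph.ends G) (sym (q e))
        r : map f f (Graph.ends A e) ≡ map f′ f′ (Graph.ends A e)
        r = cong₂ _,_ (p _) (p _)

      qResp : ∀ {f f′ g g′} → f ≗ f′ → g ≗ g′ → Q f g → Q f′ g′
      qResp p q (i , j , k , l) = injResp p i , injResp q j , (λ e → incResp p q e (k e)) , respR q l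

      pair? : (x y : Fin (order G) × Fin (order G)) → Dec (x ≡ y)
      pair? = Product.≡-dec Fin._≟_ Fin._≟_

      q? : ∀ f g → Dec (Q f g)
      q? f g = injective? a f ×-dec injective? b g ×-dec
        allOver b (λ e → pair? _ _ ⊎-dec pair? _ _) ×-dec R? g

    embed? : Dec (Σ (A ↪ graph G) (R ∘ onE))
    embed? = map′
      (λ (f , g , i , j , k , l) → record { onV = f ; onE = g ; injectV = i _ _ ; injectE = j _ _ ; incidence = k } , l)
      (λ (m , l) → onV m , onE m , (λ _ _ → injectV m) , (λ _ _ → injectE m) , incidence m , l)
      (search a (λ p (g , h) → g , qResp p (λ _ → refl) h)
                (λ f → search b (qResp (λ _ → refl)) (q? f)))

  countResp : ∀ {n k} {f g : Fin n → Fin k} → f ≗ g → countDistinct f ≡ countDistinct g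
  countResp p = cong (length ∘ deduplicate Fin._≟_) (tabulate-cong p)

  validResp : ∀ p G {k} {c d : Fin (size G) → Fin k} → c ≗ d → ArbColouring p G c → ArbColouring p G d
  validResp p G c≗d h C = ℕ.≤-trans (h C) (ℕ.≤-reflexive (countResp (c≗d ∘ Cycle.edge C)))

  valid? : ∀ p G {k} (c : Fin (size G) → Fin k) → Dec (ArbColouring p G c)
  valid? p G c = map′ to from (¬? (any? {order G} (λ i → bad? (toℕ i))))
    where
    Bad : ℕ → Set
    Bad k = Σ (cycleGraph k ↪ graph G) λ m → ¬ ((2 ℕ.+ k) ⊓ (p ℕ.+ 1) ≤ countDistinct (c ∘ onE m))
    bad? : ∀ k → Dec (Bad k)
    bad? k = embed? (cycleGraph k) (enumFin _) (enumFin _) G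
      (λ f≗g h l → h (ℕ.≤-trans l (ℕ.≤-reflexive (sym (countResp (cong c ∘ f≗g))))))
      (λ f → ¬? (_ ℕ.≤? _))
    to : ¬ (∃ λ (i : Fin (order G)) → Bad (toℕ i)) → ArbColouring p G c
    to none record { excess = k ; copy = m } = decidable-stable (_ ℕ.≤? _) λ h →
      none (fromℕ< k<n , subst Bad (sym (toℕ-fromℕ< k<n)) (m , h))
      where
      k<n : k < order G
      k<n = ℕ.≤-trans (ℕ.n≤1+n _) (injective⇒≤ (injectV m))
    from : ArbColouring p G c → ¬ (∃ λ (i : Fin (order G)) → Bad (toℕ i))
    from h (i , m , no≤) = no≤ (h record { excess = toℕ i ; copy = m })

  colourable? : ∀ p G k → Dec (ArbColourable p G k)
  colourable? p G k = search (enumFin _) (validResp p G) (valid? p G)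

  dedup-unique : ∀ {k} {xs : List (Fin k)} → Unique xs → deduplicate Fin._≟_ xs ≡ xs
  dedup-unique []       = refl
  dedup-unique (p ∷ ps) rewrite dedup-unique ps = cong (_ ∷_) (filter-all _ p)

  rainbow : ∀ p G → ArbColourable p G (size G)
  rainbow p G = id , λ C → ℕ.≤-trans (ℕ.m⊓n≤m _ _) (ℕ.≤-reflexive (sym
    (trans (cong length (dedup-unique (tabulate⁺ (injectE (Cycle.copy C))))) (length-tabulate (Cycle.edge C)))))

  least : {P : ℕ → Set} → (∀ n → Dec (P n)) → ∀ n → P n → ∃[ k ] P k × (∀ j → P j → k ≤ j)
  least {P} P? = <-rec _ step
    where
    step : ∀ n → (∀ {m} → m < n → P m → ∃[ k ] P k × (∀ j → P j → k ≤ j)) →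
           P n → ∃[ k ] P k × (∀ j → P j → k ≤ j)
    step n rec pn with any? {n} (P? ∘ toℕ)
    ... | yes (i , pi) = rec (toℕ<n i) pi
    ... | no none      = n , pn , λ j pj → ℕ.≮⇒≥ λ j<n →
      none (fromℕ< j<n , subst P (sym (toℕ-fromℕ< j<n)) pj)

  Realised : (t : ℕ) (G : Multigraph) → ℕ × ℕ → Set
  Realised t G (n , m) = ∃[ H ] ShallowTopMinor t H G × (order H , size H) ≡ (n , m)

  module _ {n m : ℕ} {ends ends′ : Fin m → Fin n × Fin n}
           (l : ∀ e → proj₁ (ends e) ≢ proj₂ (ends e)) (l′ : ∀ e → proj₁ (ends′ e) ≢ proj₂ (ends′ e))
           {s s′ : Fin m → ℕ} (ends≗ : ends′ ≗ ends) (s≗ : s′ ≗ s) (G : Multigraph) where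

    private
      A A′ : Graph
      A  = subdivide (record { order = n ; size = m ; ends = ends  ; loopless = l  }) s
      A′ = subdivide (record { order = n ; size = m ; ends = ends′ ; loopless = l′ }) s′

      toV : Graph.V A′ → Graph.V A
      toV (inj₁ x)       = inj₁ x
      toV (inj₂ (e , j)) = inj₂ (e , subst Fin (s≗ e) j)

      toE : Graph.E A′ → Graph.E A
      toE (e , i) = e , subst (Fin ∘ suc) (s≗ e) i

      fromV : Graph.V A → Graph.V A′
      fromV (inj₁ x)       = inj₁ x
      fromV (inj₂ (e , j)) = inj₂ (e , subst Fin (sym (s≗ e)) j)

      fromE : Graph.E A → Graph.E A′
      fromE (e , i) = e , subst (Fin ∘ suc) (sym (s≗ e)) i

      fromToV : ∀ x → fromV (toV x) ≡ x
      fromToV (inj₁ x)       = refl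
      fromToV (inj₂ (e , j)) = cong (λ k → inj₂ (e , k)) (subst-sym-subst (s≗ e))

      fromToE : ∀ x → fromE (toE x) ≡ x
      fromToE (e , i) = cong (e ,_) (subst-sym-subst (s≗ e))

      cons-subst : ∀ {X Y : Set} {k k′} (eq : k′ ≡ k) (h : Y → X) {f : Fin k → X} {f′ : Fin k′ → Y} {y y′} →
                   (∀ j → h (f′ j) ≡ f (subst Fin eq j)) → h y′ ≡ y →
                   ∀ i → h (cons y′ f′ i) ≡ cons y f (subst (Fin ∘ suc) eq i)
      cons-subst refl h p q zero    = q
      cons-subst refl h p q (suc i) = p i

      snoc-subst : ∀ {X Y : Set} {k k′} (eq : k′ ≡ k) (h : Y → X) {f : Fin k → X} {f′ : Fin k′ → Y} {y y′} →
                   (∀ j → h (f′ j) ≡ f (subst Fin eq j)) → h y′ ≡ y →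
                   ∀ i → h (snoc f′ y′ i) ≡ snoc f y (subst (Fin ∘ suc) eq i)
      snoc-subst {k = zero}  refl h p q zero    = q
      snoc-subst {k = suc _} refl h p q zero    = p zero
      snoc-subst {k = suc _} refl h p q (suc i) = snoc-subst refl h (p ∘ suc) q i

      endsTo : ∀ x → map toV toV (Graph.ends A′ x) ≡ Graph.ends A (toE x)
      endsTo (e , i) = cong₂ _,_
        (cons-subst (s≗ e) toV (λ _ → refl) (cong (inj₁ ∘ proj₁) (ends≗ e)) i)
        (snoc-subst (s≗ e) toV (λ _ → refl) (cong (inj₁ ∘ proj₂) (ends≗ e)) i)

    transport : A ↪ graph G → A′ ↪ graph G
    transport φ = record
      { onV       = onV φ ∘ toV
      ; onE       = onE φ ∘ toE
      ; injectV   = λ {x} {y} e → trans (sym (fromToV x)) (trans (cong fromV (injectV φ e)) (fromToV y))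
      ; injectE   = λ {x} {y} e → trans (sym (fromToE x)) (trans (cong fromE (injectE φ e)) (fromToE y))
      ; incidence = λ x → Sum.map
          (λ h → trans h (cong (map (onV φ) (onV φ)) (sym (endsTo x))))
          (λ h → trans h (cong (swap ∘ map (onV φ) (onV φ)) (sym (endsTo x))))
          (incidence φ (toE x))
      }

  module _ (t : ℕ) (G : Multigraph) where

    private
      Model : ∀ {n m} → (Fin m → Fin n) → (Fin m → Fin n) → (Fin m → Fin (suc t)) → Set
      Model {n} {m} u v s = Σ (∀ e → u e ≢ v e) λ l →
        subdivide (record { order = n ; size = m ; ends = λ e → u e , v e ; loopless = l }) (toℕ ∘ s) ↪ graph G

      modelResp : ∀ {n m} {u u′ v v′ : Fin m → Fin n} {s s′ : Fin m → Fin (suc t)} →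
                  u ≗ u′ → v ≗ v′ → s ≗ s′ → Model u v s → Model u′ v′ s′
      modelResp p q r (l , φ) =
        l′ ,
        transport l l′ (λ e → sym (cong₂ _,_ (p e) (q e))) (λ e → sym (cong toℕ (r e))) G φ
        where l′ = λ e h → l e (trans (p e) (trans h (sym (q e))))

      model? : ∀ {n m} (u v : Fin m → Fin n) (s : Fin m → Fin (suc t)) → Dec (Model u v s)
      model? u v s with all? (λ e → ¬? (u e Fin.≟ v e))
      ... | no ¬l = no (¬l ∘ proj₁)
      ... | yes l = map′ (λ (φ , _) → l , φ)
              (λ (l′ , φ) → transport l′ l (λ _ → refl) (λ _ → refl) G φ , tt)
              (embed? (subdivide (record { loopless = l }) (toℕ ∘ s))
                (enum⊎ (enumFin _) (enumΣ _)) (enumΣ (suc ∘ toℕ ∘ s)) G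
                (λ _ _ → tt) (λ _ → yes tt))

    realised? : ∀ nm → Dec (Realised t G nm)
    realised? (n , m) = map′ to from
      (search (enumFin m) (λ p (v , s , h) → v , s , modelResp p (λ _ → refl) (λ _ → refl) h) λ u →
       search (enumFin m) (λ p (s , h) → s , modelResp (λ _ → refl) p (λ _ → refl) h) λ v →
       search (enumFin m) (modelResp (λ _ → refl) (λ _ → refl)) (model? u v))
      where
      Found : Set
      Found = ∃[ u ] ∃[ v ] ∃[ s ] Model {n} {m} u v s
      to : Found → Realised t G (n , m)
      to (u , v , s , l , φ) = record { loopless = l } , (toℕ ∘ s , (λ e → s≤s⁻¹ (toℕ<n (s e))) , φ) , refl
      from : Realised t G (n , m) → Found
      from (H , (s , s≤t , φ) , refl) =
        proj₁ ∘ Multigraph.ends H , proj₂ ∘ Multigraph.ends H , (λ e → fromℕ< (s≤s (s≤t e))) ,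
        Multigraph.loopless H , transport (Multigraph.loopless H) (Multigraph.loopless H) (λ _ → refl) (λ e → toℕ-fromℕ< (s≤s (s≤t e))) G φ

    realised-order : ∀ H → ShallowTopMinor t H G → order H ≤ order G
    realised-order _ (s , _ , φ) = injective⇒≤ (λ e → inj₁-injective (injectV φ e))

    realised-size : ∀ H → ShallowTopMinor t H G → size H ≤ size G
    realised-size _ (s , _ , φ) = injective⇒≤ {f = λ e → onE φ (e , zero)} (λ e → cong proj₁ (injectE φ e))

    empty : Realised t G (0 , 0)
    empty = record { ends = λ () ; loopless = λ () } , ((λ ()) , (λ ()) , record
      { onV = λ { (inj₁ ()) ; (inj₂ ()) } ; onE = λ () ; injectV = λ { {inj₁ ()} ; {inj₂ ()} }
      ; injectE = λ { {()} } ; incidence = λ () }) , refl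

    maxRatio : ∃ (IsTopGrad t G)
    maxRatio = f best , record
      { attained = let (H , st , eq) = best-realised in H , st , cong f eq
      ; bound    = λ H st → All.lookup (f[xs]≤f[argmax] {f = f} (0 , 0) cands)
          (∈-filter⁺ realised? (∈-cartesianProduct⁺ (∈-upTo⁺ (s≤s (realised-order H st))) (∈-upTo⁺ (s≤s (realised-size H st))))
            (H , st , refl))
      }
      where
      open Extrema (DecTotalOrder.totalOrder ℚ.≤-decTotalOrder)
      f : ℕ × ℕ → ℚ
      f (n , m) = ratio n m
      all cands : List (ℕ × ℕ)
      all   = cartesianProduct (upTo (suc (order G))) (upTo (suc (size G)))
      cands = filter realised? all
      best : ℕ × ℕ
      best = argmax f (0 , 0) cands
      best-realised : Realised t G best
      best-realised = argmax-all f empty (all-filter realised? all)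

abstract
  arb-exists : ∀ p G → ∃ (IsArb p G)
  arb-exists p G = let (k , c , h) = least (colourable? p G) (size G) (rainbow p G)
                   in  k , record { colourable = c ; minimal = h }

  topGrad-exists : ∀ t G → ∃ (IsTopGrad t G)
  topGrad-exists = maxRatio

Arb : ℕ → Multigraph → ℕ
Arb p G = proj₁ (arb-exists p G)

Arb-isArb : ∀ p G → IsArb p G (Arb p G)
Arb-isArb p G = proj₂ (arb-exists p G)

-- Here too t = 2r.
∇̃ᵐ : ℕ → Multigraph → ℚ
∇̃ᵐ t G = proj₁ (topGrad-exists t G)

∇̃ᵐ-isTopGrad : ∀ t G → IsTopGrad t G (∇̃ᵐ t G)
∇̃ᵐ-isTopGrad t G = proj₂ (topGrad-exists t G)

{-# OPTIONS --safe #-}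
-- Lower bound.  Give every edge of a shallow topological minor H the sequence of at most p colours
-- on the path replacing it.  Edges of H with the same sequence form a forest, since a cycle among
-- them would be a cycle of G with a repeated colour and at most p colours; and there are at most
-- Arb^p sequences.
--
-- Upper bound (fraternal augmentation).  Orient the edges of G with bounded in-degree, and whenever
-- two oriented paths q : x → z and r : y → z of total length at most p form a path from x to y,
-- add that path and orient it too.  In-degrees stay bounded: every vertex and edge lies on few new
-- paths, so many new paths with ends in a set S would contain many disjoint ones with interior
-- outside S, that is, a dense shallow topological minor.  Colour the edges of G so that an edge on
-- a path into z differs from all other edges on paths into z or into a recent ancestor of z; these
-- conflicts have bounded out-degree, hence few colours suffice.  Now cut a cycle into single
-- edges and keep merging two consecutive pieces that point to their common end z.  If the two
-- pieces have more than p edges or form the whole cycle, they are rainbow.  If no merge is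
-- possible, the pieces form a directed closed walk, and p + 1 consecutive ones (or all) are rainbow.
-- Every bound is a polynomial in the preceding ones.
module Submission where

open import Defs

-- Merging takes place at heads because in-degree is the quantity under control: a vertex may be the
-- start of arbitrarily many arcs, but few arcs share a head, so the number of merged paths through
-- a vertex or an edge stays bounded in terms of the previous bounds. Arcs are stored as whole
-- paths, and two paths with the same ends remain two arcs: the colouring has to see the edges
-- inside, and the disjoint family extracted from them may contain parallel paths, which is why its
-- size is governed by the density of multigraphs. A path with i + 1 inner vertices is merged from
-- paths with at most i, so t = p - 1 rounds, ordered by the number of inner vertices, create every
-- path that is asked for later. Densities are rational while all the counting is in naturals. The
-- floor of the density plus one serves as the integer bound k; it is at most one plus the density,
-- and so the final polynomial has the form c(1 + x)^e.

module Arboricity where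
  open import Data.Bool using (Bool; true; false; if_then_else_)
  open import Data.Fin as Fin using (Fin; zero; suc; punchIn; punchOut; finToFun; funToFin)
  import Data.Fin.Properties as Fin
  import Data.Integer as ℤ
  import Data.Integer.Properties as ℤ
  open import Data.List
    using (List; []; _∷_; _++_; length; map; reverse; filter; concatMap; lookup; allFin; tabulate)
  open import Data.List.Membership.Propositional using (_∈_; _∉_; find; lose)
  open import Data.List.Membership.Propositional.Properties
  import Data.List.Membership.DecPropositional as DecMem
  open import Data.List.Properties
    using (length-++; length-map; length-tabulate; map-++; filter-notAll; ++-assoc; reverse-++; unfold-reverse)
  open import Data.List.Relation.Unary.All as All using (All; []; _∷_)
  import Data.List.Relation.Unary.All.Properties as All
  open import Data.List.Relation.Unary.AllPairs as AllPairs using (AllPairs; []; _∷_)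
  import Data.List.Relation.Unary.AllPairs.Properties as AllPairs
  open import Data.List.Relation.Unary.Any as Any using (Any; here; there; index)
  open import Data.List.Relation.Unary.Any.Properties using (lookup-index; reverse⁺; reverse⁻)
  open import Data.List.Relation.Unary.Unique.DecPropositional using (unique?)
  open import Data.List.Relation.Unary.Unique.DecPropositional.Properties using (deduplicate-!)
  open import Data.List.Relation.Unary.Unique.Propositional using (Unique)
  import Data.List.Relation.Unary.Unique.Propositional.Properties as Unique
  open import Data.Nat as ℕ using (ℕ; zero; suc; _+_; _*_; _^_; _⊓_; _≤_; _≤?_; z≤n; s≤s; s≤s⁻¹)
  open import Data.Nat.DivMod using (m≡m%n+[m/n]*n; m%n<n; m/n*n≤m)
  open import Data.Nat.Properties
  open import Data.Product as Product using (Σ-syntax; ∃-syntax; _×_; _,_; proj₁; proj₂)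
  open import Data.Rational as ℚ using (ℚ; 0ℚ; 1ℚ)
  import Data.Rational.Properties as ℚ
  open import Data.Rational.Solver using (module +-*-Solver)
  import Data.Rational.Unnormalised as ℚᵘ
  import Data.Rational.Unnormalised.Properties as ℚᵘ
  open import Data.Sum as Sum using (_⊎_; inj₁; inj₂)
  open import Data.Sum.Properties using (inj₁-injective; inj₂-injective; swap-involutive; ≡-dec)
  open import Data.Unit using (⊤; tt)
  open import Data.Vec.Functional using () renaming (_∷_ to cons)
  open import Function using (_∘_)
  open import Function.Definitions using (Injective)
  open import Relation.Binary.Definitions using (DecidableEquality)
  open import Relation.Binary.PropositionalEquality
    using (_≡_; _≢_; refl; sym; trans; cong; cong₂; subst; subst₂)
  open import Relation.Nullary using (Dec; yes; no; ¬_; ¬?; contradiction)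
  open import Relation.Nullary.Decidable using (_×-dec_)

  private variable
    A B P Q X Y : Set

  -- Counting in lists

  ⟦_⟧ : Dec P → ℕ
  ⟦ yes _ ⟧ = 1
  ⟦ no _ ⟧ = 0

  ⟦⟧≤1 : (d : Dec P) → ⟦ d ⟧ ≤ 1
  ⟦⟧≤1 (yes _) = ≤-refl
  ⟦⟧≤1 (no _) = z≤n

  ⟦⟧-mono : (d : Dec P) (d′ : Dec Q) → (P → Q) → ⟦ d ⟧ ≤ ⟦ d′ ⟧
  ⟦⟧-mono (yes p) (yes q) f = ≤-refl
  ⟦⟧-mono (yes p) (no ¬q) f = contradiction (f p) ¬q
  ⟦⟧-mono (no ¬p) d′ f = z≤n

  ⟦⟧-yes : (d : Dec P) → P → ⟦ d ⟧ ≡ 1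
  ⟦⟧-yes (yes _) _ = refl
  ⟦⟧-yes (no ¬p) p = contradiction p ¬p

  ⟦⟧-≤ : (d : Dec P) {n : ℕ} → (P → 1 ≤ n) → ⟦ d ⟧ ≤ n
  ⟦⟧-≤ (yes p) f = f p
  ⟦⟧-≤ (no _) f = z≤n

  ⟦⟧*-≤ : (d : Dec P) {m n : ℕ} → (P → m ≤ n) → ⟦ d ⟧ * m ≤ n
  ⟦⟧*-≤ (yes p) f = ≤-trans (≤-reflexive (+-identityʳ _)) (f p)
  ⟦⟧*-≤ (no _) f = z≤n

  1≤⟦⟧ : (d : Dec P) → P → 1 ≤ ⟦ d ⟧
  1≤⟦⟧ d p = ≤-reflexive (sym (⟦⟧-yes d p))

  1≤⟦⟧*⟦⟧ : (d : Dec P) (d′ : Dec Q) → P → Q → 1 ≤ ⟦ d ⟧ * ⟦ d′ ⟧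
  1≤⟦⟧*⟦⟧ d d′ p q = *-mono-≤ (1≤⟦⟧ d p) (1≤⟦⟧ d′ q)

  ∑ : List A → (A → ℕ) → ℕ
  ∑ [] f = 0
  ∑ (x ∷ xs) f = f x + ∑ xs f

  ∑-mono : (xs : List A) {f g : A → ℕ} → (∀ x → x ∈ xs → f x ≤ g x) → ∑ xs f ≤ ∑ xs g
  ∑-mono [] h = z≤n
  ∑-mono (x ∷ xs) h = +-mono-≤ (h x (here refl)) (∑-mono xs (λ y y∈ → h y (there y∈)))

  ∑-cong : (xs : List A) {f g : A → ℕ} → (∀ x → f x ≡ g x) → ∑ xs f ≡ ∑ xs g
  ∑-cong [] h = refl
  ∑-cong (x ∷ xs) h = cong₂ _+_ (h x) (∑-cong xs h)

  ∑-zero : (xs : List A) → ∑ xs (λ _ → 0) ≡ 0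
  ∑-zero [] = refl
  ∑-zero (x ∷ xs) = ∑-zero xs

  ∑-one : (xs : List A) → ∑ xs (λ _ → 1) ≡ length xs
  ∑-one [] = refl
  ∑-one (x ∷ xs) = cong suc (∑-one xs)

  +-interchange : ∀ a b c d → (a + b) + (c + d) ≡ (a + c) + (b + d)
  +-interchange a b c d = trans (+-assoc a b (c + d))
      (trans (cong (a +_) (trans (sym (+-assoc b c d))
    (trans (cong (_+ d) (+-comm b c)) (+-assoc c b d)))) (sym (+-assoc a c (b + d))))

  ∑-+ : (xs : List A) (f g : A → ℕ) → ∑ xs (λ x → f x + g x) ≡ ∑ xs f + ∑ xs g
  ∑-+ [] f g = refl
  ∑-+ (x ∷ xs) f g = trans (cong ((f x + g x) +_) (∑-+ xs f g)) (+-interchange (f x) (g x) _ _)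

  ∑-*ʳ : (xs : List A) (f : A → ℕ) (c : ℕ) → ∑ xs (λ x → f x * c) ≡ ∑ xs f * c
  ∑-*ʳ [] f c = refl
  ∑-*ʳ (x ∷ xs) f c = trans (cong (f x * c +_) (∑-*ʳ xs f c)) (sym (*-distribʳ-+ c (f x) _))

  ∑-*ˡ : (xs : List A) (f : A → ℕ) (c : ℕ) → ∑ xs (λ x → c * f x) ≡ c * ∑ xs f
  ∑-*ˡ xs f c = trans (∑-cong xs (λ x → *-comm c (f x))) (trans (∑-*ʳ xs f c) (*-comm _ c))

  ∑-const : (xs : List A) (c : ℕ) → ∑ xs (λ _ → c) ≡ length xs * c
  ∑-const [] c = refl
  ∑-const (x ∷ xs) c = cong (c +_) (∑-const xs c)

  ∑-≤-const : (xs : List A) {f : A → ℕ} {c : ℕ} → (∀ x → x ∈ xs → f x ≤ c) → ∑ xs f ≤ length xs * c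
  ∑-≤-const xs h = ≤-trans (∑-mono xs h) (≤-reflexive (∑-const xs _))

  ∑-swap : (xs : List A) (ys : List B) (f : A → B → ℕ) →
           ∑ xs (λ x → ∑ ys (f x)) ≡ ∑ ys (λ y → ∑ xs (λ x → f x y))
  ∑-swap [] ys f = sym (∑-zero ys)
  ∑-swap (x ∷ xs) ys f = trans (cong (∑ ys (f x) +_) (∑-swap xs ys f)) (sym (∑-+ ys (f x) _))

  ∑-++ : (xs ys : List A) (f : A → ℕ) → ∑ (xs ++ ys) f ≡ ∑ xs f + ∑ ys f
  ∑-++ [] ys f = refl
  ∑-++ (x ∷ xs) ys f = trans (cong (f x +_) (∑-++ xs ys f)) (sym (+-assoc (f x) _ _))

  ∑-map : (g : A → B) (xs : List A) (f : B → ℕ) → ∑ (map g xs) f ≡ ∑ xs (f ∘ g)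
  ∑-map g [] f = refl
  ∑-map g (x ∷ xs) f = cong (f (g x) +_) (∑-map g xs f)

  ∑-concatMap : (g : A → List B) (xs : List A) (f : B → ℕ) →
      ∑ (concatMap g xs) f ≡ ∑ xs (λ x → ∑ (g x) f)
  ∑-concatMap g [] f = refl
  ∑-concatMap g (x ∷ xs) f = trans (∑-++ (g x) _ f) (cong (∑ (g x) f +_) (∑-concatMap g xs f))

  ∑-filter : {R : A → Set} (R? : ∀ x → Dec (R x)) (xs : List A) (f : A → ℕ) →
             ∑ (filter R? xs) f ≡ ∑ xs (λ x → ⟦ R? x ⟧ * f x)
  ∑-filter R? [] f = refl
  ∑-filter R? (x ∷ xs) f with R? x
  ... | yes _ = cong₂ _+_ (sym (+-identityʳ (f x))) (∑-filter R? xs f)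
  ... | no _ = ∑-filter R? xs f

  length-filter-∑ : {R : A → Set} (R? : ∀ x → Dec (R x)) (xs : List A) →
                    length (filter R? xs) ≡ ∑ xs (λ x → ⟦ R? x ⟧)
  length-filter-∑ R? xs = trans (sym (∑-one (filter R? xs)))
      (trans (∑-filter R? xs (λ _ → 1)) (∑-cong xs (λ x → *-identityʳ _)))

  length-concatMap : (g : A → List B) (xs : List A) → length (concatMap g xs) ≡ ∑ xs (length ∘ g)
  length-concatMap g xs = trans (sym (∑-one (concatMap g xs)))
      (trans (∑-concatMap g xs (λ _ → 1)) (∑-cong xs (λ x → ∑-one (g x))))

  ∈⇒≤∑ : {x : A} {xs : List A} (f : A → ℕ) → x ∈ xs → f x ≤ ∑ xs f
  ∈⇒≤∑ f (here refl) = m≤m+n _ _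
  ∈⇒≤∑ f (there x∈) = ≤-trans (∈⇒≤∑ f x∈) (m≤n+m _ _)

  lookup-injective : {xs : List A} → Unique xs → ∀ i j → lookup xs i ≡ lookup xs j → i ≡ j
  lookup-injective (p ∷ ps) zero zero eq = refl
  lookup-injective {xs = x ∷ xs} (p ∷ ps) zero (suc j) eq =
      contradiction eq (All.lookup p (∈-lookup {xs = xs} j))
  lookup-injective {xs = x ∷ xs} (p ∷ ps) (suc i) zero eq =
      contradiction (sym eq) (All.lookup p (∈-lookup {xs = xs} i))
  lookup-injective (p ∷ ps) (suc i) (suc j) eq = cong suc (lookup-injective ps i j eq)

  unique-⊆⇒length≤ : {xs ys : List A} → Unique xs → (∀ {x} → x ∈ xs → x ∈ ys) →
      length xs ≤ length ys
  unique-⊆⇒length≤ {xs = xs} {ys} u sub = Fin.injective⇒≤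
      {f = λ i → index (sub (∈-lookup {xs = xs} i))} λ {i} {j} eq →
    lookup-injective u i j (trans (lookup-index (sub (∈-lookup {xs = xs} i)))
        (trans (cong (lookup ys) eq) (sym (lookup-index (sub (∈-lookup {xs = xs} j))))))

  tail-∈ : {x y : A} {xs : List A} → y ∈ x ∷ xs → y ≢ x → y ∈ xs
  tail-∈ (here eq) ne = contradiction eq ne
  tail-∈ (there y∈) ne = y∈

  module _ (_≟_ : DecidableEquality A) where
    open DecMem _≟_ using (_∈?_)

    ∑-≟ : {xs : List A} → Unique xs → ∀ y → ∑ xs (λ x → ⟦ y ≟ x ⟧) ≤ ⟦ y ∈? xs ⟧
    ∑-≟ [] y = z≤n
    ∑-≟ {xs = x ∷ xs} (p ∷ ps) y = step (y ≟ x) (y ∈? (x ∷ xs))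
      where
      step : (d : Dec (y ≡ x)) (d′ : Dec (y ∈ x ∷ xs)) → ⟦ d ⟧ + ∑ xs (λ x → ⟦ y ≟ x ⟧) ≤ ⟦ d′ ⟧
      step (no ne) d′ = ≤-trans (∑-≟ ps y) (⟦⟧-mono (y ∈? xs) d′ there)
      step (yes refl) (no y∉) = contradiction (here refl) y∉
      step (yes refl) (yes _) = +-monoʳ-≤ 1 (≤-trans (∑-≟ ps y)
        (⟦⟧-≤ (y ∈? xs) (λ y∈ → contradiction refl (All.lookup p y∈))))

  missing-colour : ∀ {k} (cs : List (Fin (suc k))) → length cs ≤ k → ∃[ c ] c ∉ cs
  missing-colour {k} cs l with Fin.any? (λ c → ¬? (DecMem._∈?_ Fin._≟_ c cs))
  ... | yes r = r
  ... | no none = contradiction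
    (≤-trans (≤-reflexive (sym (length-tabulate (λ i → i))))
        (≤-trans (unique-⊆⇒length≤ (Unique.allFin⁺ (suc k)) cover) l)) 1+n≰n
    where
    cover : ∀ {c} → c ∈ allFin (suc k) → c ∈ cs
    cover {c} _ with DecMem._∈?_ Fin._≟_ c cs
    ... | yes c∈ = c∈
    ... | no c∉ = contradiction (c , c∉) none

  -- Degeneracy

  module Degeneracy {X A : Set} (_≟_ : DecidableEquality X) (as : List A) (s t : A → X) (d : ℕ)
      where
    open DecMem _≟_ using (_∈?_)

    inside : List X → A → ℕ
    inside S a = ⟦ s a ∈? S ⟧ * ⟦ t a ∈? S ⟧

    degree : List X → X → ℕ
    degree S v = ∑ as λ a → ⟦ s a ≟ v ⟧ * ⟦ t a ∈? S ⟧ + ⟦ t a ≟ v ⟧ * ⟦ s a ∈? S ⟧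

    degree-mono : ∀ {S T} v → (∀ {x} → x ∈ S → x ∈ T) → degree S v ≤ degree T v
    degree-mono v sub = ∑-mono as λ a _ → +-mono-≤
      (*-monoʳ-≤ ⟦ s a ≟ v ⟧ (⟦⟧-mono (t a ∈? _) (t a ∈? _) sub))
      (*-monoʳ-≤ ⟦ t a ≟ v ⟧ (⟦⟧-mono (s a ∈? _) (s a ∈? _) sub))

    -- Handshaking: a pair inside `S` is counted at most once from each of its two ends, since `S`
    -- has no repetition.
    ∑degree≤ : ∀ {S} → Unique S → ∑ S (degree S) ≤ 2 * ∑ as (inside S)
    ∑degree≤ {S} u = begin
      ∑ S (degree S) ≡⟨ ∑-swap S as _ ⟩
      ∑ as (λ a → ∑ S (λ v → ⟦ s a ≟ v ⟧ * ⟦ t a ∈? S ⟧ + ⟦ t a ≟ v ⟧ * ⟦ s a ∈? S ⟧))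
          ≤⟨ ∑-mono as (λ a _ → at a) ⟩
      ∑ as (λ a → inside S a + inside S a) ≡⟨ ∑-+ as _ _ ⟩
      ∑ as (inside S) + ∑ as (inside S) ≡⟨ cong (∑ as (inside S) +_) (sym (+-identityʳ _)) ⟩
      2 * ∑ as (inside S) ∎
      where
      open ≤-Reasoning
      half : ∀ x c → ∑ S (λ v → ⟦ x ≟ v ⟧ * c) ≤ ⟦ x ∈? S ⟧ * c
      half x c = ≤-trans (≤-reflexive (∑-*ʳ S _ c)) (*-monoˡ-≤ c (∑-≟ _≟_ u x))
      at : ∀ a → ∑ S (λ v → ⟦ s a ≟ v ⟧ * ⟦ t a ∈? S ⟧ + ⟦ t a ≟ v ⟧ * ⟦ s a ∈? S ⟧) ≤ inside S a +
          inside S a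
      at a = ≤-trans (≤-reflexive (∑-+ S _ _)) (+-mono-≤ (half (s a) _)
        (≤-trans (half (t a) _) (≤-reflexive (*-comm ⟦ t a ∈? S ⟧ _))))

    -- Each entry has few neighbours among the entries behind it. The colouring fills the list from
    -- the back; the orientation lets every pair point to whichever of its ends comes first.
    data Degenerate : List X → Set where
      []   : Degenerate []
      insert : ∀ {v vs} → v ∉ vs → degree vs v ≤ 2 * d → Degenerate vs → Degenerate (v ∷ vs)

    module _ (sparse : ∀ S → Unique S → ∑ as (inside S) ≤ length S * d) where

      -- Averaging: if every degree were at least `2 * d + 1`, the degree sum would exceed twice the
      -- number of pairs inside.
      low-degree : ∀ x S → Unique (x ∷ S) → Any (λ v → degree (x ∷ S) v ≤ 2 * d) (x ∷ S)
      low-degree x S u with Any.any? (λ v → degree (x ∷ S) v ≤? 2 * d) (x ∷ S)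
      ... | yes r = r
      ... | no none = contradiction bound (<⇒≱ (*-monoʳ-< (suc (length S)) (n<1+n (2 * d))))
        where
        open ≤-Reasoning
        T = x ∷ S
        high : ∀ v → v ∈ T → suc (2 * d) ≤ degree T v
        high v v∈ = ≰⇒> λ le → none (lose v∈ le)
        bound : length T * suc (2 * d) ≤ length T * (2 * d)
        bound = begin
          length T * suc (2 * d) ≡⟨ sym (∑-const T _) ⟩
          ∑ T (λ _ → suc (2 * d)) ≤⟨ ∑-mono T high ⟩
          ∑ T (degree T) ≤⟨ ∑degree≤ u ⟩
          2 * ∑ as (inside T) ≤⟨ *-monoʳ-≤ 2 (sparse T u) ⟩
          2 * (length T * d) ≡⟨ sym (*-assoc 2 (length T) d) ⟩
          2 * length T * d ≡⟨ cong (_* d) (*-comm 2 (length T)) ⟩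
          length T * 2 * d ≡⟨ *-assoc (length T) 2 d ⟩
          length T * (2 * d) ∎

      degenerate : ∀ n S → length S ≤ n → Unique S →
                   Σ[ vs ∈ List X ] Degenerate vs × (∀ {x} → x ∈ vs → x ∈ S) ×
                       (∀ {x} → x ∈ S → x ∈ vs)
      degenerate n [] l u = [] , [] , (λ x∈ → x∈) , (λ x∈ → x∈)
      degenerate (suc n) (x ∷ S) l u with v , v∈ , low ← find (low-degree x S u) = 
        v ∷ vs , insert (λ v∈vs → proj₂ (∈-filter⁻ ≢v? {xs = x ∷ S} (sub v∈vs)) refl)
          (≤-trans (degree-mono v (λ y∈ → proj₁ (∈-filter⁻ ≢v? (sub y∈)))) low) deg ,
        (λ { (here refl) → v∈ ; (there y∈) → proj₁ (∈-filter⁻ ≢v? (sub y∈)) }) ,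
        λ {y} y∈ → back y y∈ (y ≟ v)
        where
        ≢v? : ∀ y → Dec (y ≢ v)
        ≢v? y = ¬? (y ≟ v)
        S′ = filter ≢v? (x ∷ S)
        rec = degenerate n S′ (s≤s⁻¹ (≤-trans (filter-notAll ≢v? (x ∷ S)
            (lose v∈ (λ ne → ne refl))) l))
                (Unique.filter⁺ ≢v? u)
        vs = proj₁ rec
        deg = proj₁ (proj₂ rec)
        sub = proj₁ (proj₂ (proj₂ rec))
        sup = proj₂ (proj₂ (proj₂ rec))
        back : ∀ y → y ∈ x ∷ S → Dec (y ≡ v) → y ∈ v ∷ vs
        back y y∈ (yes refl) = here refl
        back y y∈ (no ne) = there (sup (∈-filter⁺ ≢v? y∈ ne))

    colouring : ∀ {vs} → Degenerate vs → Σ[ c ∈ (X → Fin (suc (2 * d))) ]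
      (∀ {a} → a ∈ as → s a ∈ vs → t a ∈ vs → s a ≢ t a → c (s a) ≢ c (t a))
    colouring [] = (λ _ → zero) , λ _ ()
    colouring {v ∷ vs} (insert v∉ low deg) = c , proper
      where
      c′ = proj₁ (colouring deg)
      proper′ = proj₂ (colouring deg)
      pick : ∀ {P Q : Set} → Dec P → Dec Q → X → List (Fin (suc (2 * d)))
      pick (yes _) (yes _) y = c′ y ∷ []
      pick _ _ y = []
      pick-length : ∀ {P Q : Set} (p : Dec P) (q : Dec Q) y → length (pick p q y) ≡ ⟦ p ⟧ * ⟦ q ⟧
      pick-length (yes _) (yes _) y = refl
      pick-length (yes _) (no _) y = refl
      pick-length (no _) q y = refl
      -- `pick` mirrors the summands of `degree`, so the list of blocked colours has length
      -- `degree vs v`, and one of the `2 * d + 1` colours remains.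
      pick-∈ : ∀ {P Q : Set} (p : Dec P) (q : Dec Q) y → P → Q → c′ y ∈ pick p q y
      pick-∈ (yes _) (yes _) y _ _ = here refl
      pick-∈ (yes _) (no ¬q) y _ q = contradiction q ¬q
      pick-∈ (no ¬p) q y p _ = contradiction p ¬p
      near : A → List (Fin (suc (2 * d)))
      near a = pick (s a ≟ v) (t a ∈? vs) (t a) ++ pick (t a ≟ v) (s a ∈? vs) (s a)
      used = concatMap near as
      used-length : length used ≤ 2 * d
      used-length = ≤-trans (≤-reflexive (trans (length-concatMap near as) (∑-cong as (λ a →
        trans (length-++ (pick (s a ≟ v) (t a ∈? vs) (t a)))
        (cong₂ _+_ (pick-length (s a ≟ v) (t a ∈? vs) (t a))
            (pick-length (t a ≟ v) (s a ∈? vs) (s a))))))) low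
      new = missing-colour used used-length
      c : X → Fin (suc (2 * d))
      c y with y ≟ v
      ... | yes _ = proj₁ new
      ... | no _ = c′ y
      proper : ∀ {a} → a ∈ as → s a ∈ v ∷ vs → t a ∈ v ∷ vs → s a ≢ t a → c (s a) ≢ c (t a)
      proper {a} a∈ s∈ t∈ ne with s a ≟ v | t a ≟ v
      ... | yes p | yes q = contradiction (trans p (sym q)) ne
      ... | yes p | no q = λ eq → proj₂ new (subst (_∈ used) (sym eq)
          (∈-concatMap⁺ near {xs = as} (lose a∈
          (∈-++⁺ˡ (pick-∈ (s a ≟ v) (t a ∈? vs) (t a) p (tail-∈ t∈ q))))))
      ... | no p | yes q = λ eq → proj₂ new (subst (_∈ used) eq
          (∈-concatMap⁺ near {xs = as} (lose a∈
          (∈-++⁺ʳ (pick (s a ≟ v) (t a ∈? vs) (t a))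
              (pick-∈ (t a ≟ v) (s a ∈? vs) (s a) q (tail-∈ s∈ p))))))
      ... | no p | no q = proper′ a∈ (tail-∈ s∈ p) (tail-∈ t∈ q) ne

    points-to-s : List X → A → Bool
    points-to-s [] a = true
    points-to-s (v ∷ vs) a with s a ≟ v | t a ≟ v
    ... | yes _ | _ = true
    ... | no _ | yes _ = false
    ... | no _ | no _ = points-to-s vs a

    head : List X → A → X
    head vs a = if points-to-s vs a then s a else t a

    private
      head-first : ∀ v {vs a} → s a ≢ t a → s a ∈ v ∷ vs → t a ∈ v ∷ vs →
        (head (v ∷ vs) a ≡ v × (s a ≡ v × t a ∈ vs ⊎ t a ≡ v × s a ∈ vs)) ⊎
        (head (v ∷ vs) a ≡ head vs a × s a ∈ vs × t a ∈ vs)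
      head-first v {vs} {a} ne s∈ t∈ with s a ≟ v | t a ≟ v
      ... | yes p | yes q = contradiction (trans p (sym q)) ne
      ... | yes p | no q = inj₁ (p , inj₁ (p , tail-∈ t∈ q))
      ... | no p | yes q = inj₁ (q , inj₂ (q , tail-∈ s∈ p))
      ... | no p | no q = inj₂ (refl , tail-∈ s∈ p , tail-∈ t∈ q)

      head-∈ : ∀ vs {a} → s a ∈ vs → t a ∈ vs → head vs a ∈ vs
      head-∈ vs {a} s∈ t∈ with points-to-s vs a
      ... | true = s∈
      ... | false = t∈

    -- All pairs that meet the first entry `w` point to `w`. Those pointing to `w` therefore have
    -- their other end in the tail and are bounded by its degree there; for any other vertex, only
    -- pairs inside the tail count.
    indegree≤ : (∀ {a} → a ∈ as → s a ≢ t a) → ∀ {vs} → Degenerate vs → ∀ v →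
                ∑ as (λ a → ⟦ s a ∈? vs ⟧ * (⟦ t a ∈? vs ⟧ * ⟦ head vs a ≟ v ⟧)) ≤ 2 * d
    indegree≤ s≢t [] v = ≤-trans (≤-reflexive (∑-zero as)) z≤n
    indegree≤ s≢t {w ∷ ws} (insert w∉ low deg) v with v ≟ w
    ... | yes refl = ≤-trans (∑-mono as at) low
      where
      at : ∀ a → a ∈ as → ⟦ s a ∈? (v ∷ ws) ⟧ * (⟦ t a ∈? (v ∷ ws) ⟧ * ⟦ head (v ∷ ws) a ≟ v ⟧)
             ≤ ⟦ s a ≟ v ⟧ * ⟦ t a ∈? ws ⟧ + ⟦ t a ≟ v ⟧ * ⟦ s a ∈? ws ⟧
      at a a∈ = ⟦⟧*-≤ (s a ∈? (v ∷ ws)) λ s∈ → ⟦⟧*-≤ (t a ∈? (v ∷ ws)) λ t∈ →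
        ⟦⟧-≤ (head (v ∷ ws) a ≟ v) λ eq → found eq (head-first v (s≢t a∈) s∈ t∈)
        where
        found : head (v ∷ ws) a ≡ v → _ → 1 ≤ ⟦ s a ≟ v ⟧ * ⟦ t a ∈? ws ⟧ + ⟦ t a ≟ v ⟧ * ⟦ s a ∈?
            ws ⟧
        found eq (inj₁ (_ , inj₁ (p , q))) = ≤-trans (1≤⟦⟧*⟦⟧ (s a ≟ v) (t a ∈? ws) p q) (m≤m+n _ _)
        found eq (inj₁ (_ , inj₂ (p , q))) = ≤-trans (1≤⟦⟧*⟦⟧ (t a ≟ v) (s a ∈? ws) p q) (m≤n+m _ _)
        found eq (inj₂ (h , p , q)) = contradiction
            (subst (_∈ ws) (trans (sym h) eq) (head-∈ ws p q)) w∉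
    ... | no v≢w = ≤-trans (∑-mono as at) (indegree≤ s≢t deg v)
      where
      at : ∀ a → a ∈ as → ⟦ s a ∈? (w ∷ ws) ⟧ * (⟦ t a ∈? (w ∷ ws) ⟧ * ⟦ head (w ∷ ws) a ≟ v ⟧)
             ≤ ⟦ s a ∈? ws ⟧ * (⟦ t a ∈? ws ⟧ * ⟦ head ws a ≟ v ⟧)
      at a a∈ = ⟦⟧*-≤ (s a ∈? (w ∷ ws)) λ s∈ → ⟦⟧*-≤ (t a ∈? (w ∷ ws)) λ t∈ →
        ⟦⟧-≤ (head (w ∷ ws) a ≟ v) λ eq → found eq (head-first w (s≢t a∈) s∈ t∈)
        where
        found : head (w ∷ ws) a ≡ v → _ → 1 ≤ ⟦ s a ∈? ws ⟧ * (⟦ t a ∈? ws ⟧ * ⟦ head ws a ≟ v ⟧)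
        found eq (inj₁ (h , _)) = contradiction (trans (sym eq) h) v≢w
        found eq (inj₂ (h , p , q)) = *-mono-≤ (1≤⟦⟧ (s a ∈? ws) p)
          (1≤⟦⟧*⟦⟧ (t a ∈? ws) (head ws a ≟ v) q (trans (sym h) eq))

    orientation : (∀ S → Unique S → ∑ as (inside S) ≤ length S * d) → (∀ {a} → a ∈ as → s a ≢ t a) →
      (S : List X) → Unique S → (∀ x → x ∈ S) →
      Σ[ b ∈ (A → Bool) ] (∀ v → ∑ as (λ a → ⟦ (if b a then s a else t a) ≟ v ⟧) ≤ 2 * d)
    orientation sparse s≢t S S! full
      with vs , deg , _ , S⊆vs ← degenerate sparse (length S) S ≤-refl S! =
      points-to-s vs , λ v → ≤-trans
        (∑-mono as λ a _ → ⟦⟧-≤ (head vs a ≟ v) λ eq → *-mono-≤ (1≤⟦⟧ (s a ∈? vs) (S⊆vs (full _)))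
          (1≤⟦⟧*⟦⟧ (t a ∈? vs) (head vs a ≟ v) (S⊆vs (full _)) eq))
        (indegree≤ s≢t deg v)

    proper-colouring : (∀ S → Unique S → ∑ as (inside S) ≤ length S * d) →
      (S : List X) → Unique S → (∀ x → x ∈ S) →
      Σ[ c ∈ (X → Fin (suc (2 * d))) ] (∀ {a} → a ∈ as → s a ≢ t a → c (s a) ≢ c (t a))
    proper-colouring sparse S S! full
      with vs , deg , _ , S⊆vs ← degenerate sparse (length S) S ≤-refl S!
      with c , proper ← colouring deg = c , λ a∈ → proper a∈ (S⊆vs (full _)) (S⊆vs (full _))

  -- Edges in a list of vertices and edges, and lists without repetition

  rights : List (X ⊎ Y) → List Y
  rights [] = []
  rights (inj₁ _ ∷ xs) = rights xs
  rights (inj₂ y ∷ xs) = y ∷ rights xs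

  rights-++ : (xs ys : List (X ⊎ Y)) → rights (xs ++ ys) ≡ rights xs ++ rights ys
  rights-++ [] ys = refl
  rights-++ (inj₁ _ ∷ xs) ys = rights-++ xs ys
  rights-++ (inj₂ y ∷ xs) ys = cong (y ∷_) (rights-++ xs ys)

  ∈-rights⁺ : {y : Y} {xs : List (X ⊎ Y)} → inj₂ y ∈ xs → y ∈ rights xs
  ∈-rights⁺ {xs = inj₁ _ ∷ xs} (there y∈) = ∈-rights⁺ y∈
  ∈-rights⁺ {xs = inj₂ _ ∷ xs} (here refl) = here refl
  ∈-rights⁺ {xs = inj₂ _ ∷ xs} (there y∈) = there (∈-rights⁺ y∈)

  ∈-rights⁻ : {y : Y} {xs : List (X ⊎ Y)} → y ∈ rights xs → inj₂ y ∈ xs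
  ∈-rights⁻ {xs = inj₁ _ ∷ xs} y∈ = there (∈-rights⁻ y∈)
  ∈-rights⁻ {xs = inj₂ _ ∷ xs} (here refl) = here refl
  ∈-rights⁻ {xs = inj₂ _ ∷ xs} (there y∈) = there (∈-rights⁻ y∈)

  rights-unique : {xs : List (X ⊎ Y)} → Unique xs → Unique (rights xs)
  rights-unique {xs = []} [] = []
  rights-unique {xs = inj₁ _ ∷ xs} (p ∷ ps) = rights-unique ps
  rights-unique {xs = inj₂ y ∷ xs} (p ∷ ps) =
    All.tabulate (λ y∈ eq → All.lookup p (∈-rights⁻ y∈) (cong inj₂ eq)) ∷ rights-unique ps

  unique-++⁻ : (xs : List X) {ys : List X} → Unique (xs ++ ys) →
               Unique xs × Unique ys × (∀ {x} → x ∈ xs → x ∉ ys)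
  unique-++⁻ [] u = [] , u , λ ()
  unique-++⁻ (x ∷ xs) (p ∷ u) with ux , uy , dis ← unique-++⁻ xs u =
    All.++⁻ˡ xs p ∷ ux , uy , λ { (here refl) y∈ → All.lookup (All.++⁻ʳ xs p) y∈ refl ; (there x∈)
        y∈ → dis x∈ y∈ }

  unique-++-comm : (xs : List X) {ys : List X} → Unique (xs ++ ys) → Unique (ys ++ xs)
  unique-++-comm xs u with ux , uy , dis ← unique-++⁻ xs u = Unique.++⁺ uy ux λ (y∈ , x∈) →
      dis x∈ y∈

  unique-reverse : {xs : List X} → Unique xs → Unique (reverse xs)
  unique-reverse [] = []
  unique-reverse {xs = x ∷ xs} (p ∷ u) = subst Unique (sym (unfold-reverse x xs))
    (Unique.++⁺ (unique-reverse u) ([] ∷ []) λ { (x∈ , here refl) → All.lookup p (reverse⁻ x∈)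
        refl })

  -- Walks

  module Walks (A : Graph) where
    open Graph A

    Joins : E → V → V → Set
    Joins e u v = ends e ≡ (u , v) ⊎ ends e ≡ (v , u)

    -- There is no empty walk: the number of edges is always one more than the number of inner
    -- vertices, as on a subdivided edge.
    data Walk : V → V → Set where
      edge : ∀ {u v} (e : E) → Joins e u v → Walk u v
      step : ∀ {u v w} (e : E) → Joins e u v → Walk v w → Walk u w

    private variable
      u v w x : V

    -- The two end vertices are not included.
    items : Walk u v → List (V ⊎ E)
    items (edge e _) = inj₂ e ∷ []
    items (step {v = v} e _ q) = inj₂ e ∷ inj₁ v ∷ items q

    inner : Walk u v → ℕ
    inner (edge _ _) = 0
    inner (step _ _ q) = suc (inner q)

    infixr 5 _∙_

    _∙_ : Walk u v → Walk v w → Walk u w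
    edge e j ∙ r = step e j r
    step e j q ∙ r = step e j (q ∙ r)

    rev : Walk u v → Walk v u
    rev (edge e j) = edge e (Sum.swap j)
    rev (step e j q) = rev q ∙ edge e (Sum.swap j)

    ∙-assoc : (q : Walk u v) (r : Walk v w) (s : Walk w x) → (q ∙ r) ∙ s ≡ q ∙ (r ∙ s)
    ∙-assoc (edge e j) r s = refl
    ∙-assoc (step e j q) r s = cong (step e j) (∙-assoc q r s)

    rev-∙ : (q : Walk u v) (r : Walk v w) → rev (q ∙ r) ≡ rev r ∙ rev q
    rev-∙ (edge e j) r = refl
    rev-∙ (step e j q) r = trans (cong (_∙ edge e (Sum.swap j)) (rev-∙ q r))
        (∙-assoc (rev r) (rev q) _)

    rev-rev : (q : Walk u v) → rev (rev q) ≡ q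
    rev-rev (edge e j) = cong (edge e) (swap-involutive j)
    rev-rev (step e j q) = trans (rev-∙ (rev q) _)
        (trans (cong (edge e (Sum.swap (Sum.swap j)) ∙_) (rev-rev q))
      (cong (λ j → step e j q) (swap-involutive j)))

    items-∙ : (q : Walk u v) (r : Walk v w) → items (q ∙ r) ≡ items q ++ inj₁ v ∷ items r
    items-∙ (edge e j) r = refl
    items-∙ (step e j q) r = cong (λ is → inj₂ e ∷ inj₁ _ ∷ is) (items-∙ q r)

    items-rev : (q : Walk u v) → items (rev q) ≡ reverse (items q)
    items-rev (edge e j) = refl
    items-rev (step {v = v} e j q) = trans (items-∙ (rev q) _)
        (trans (cong (_++ inj₁ v ∷ inj₂ e ∷ []) (items-rev q))
      (sym (reverse-++ (inj₂ e ∷ inj₁ v ∷ []) (items q))))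

    inner-∙ : (q : Walk u v) (r : Walk v w) → inner (q ∙ r) ≡ inner q + suc (inner r)
    inner-∙ (edge e j) r = refl
    inner-∙ (step e j q) r = cong suc (inner-∙ q r)

    inner-rev : (q : Walk u v) → inner (rev q) ≡ inner q
    inner-rev (edge e j) = refl
    inner-rev (step e j q) = trans (inner-∙ (rev q) _)
        (trans (+-comm (inner (rev q)) 1) (cong suc (inner-rev q)))

    length-items : (q : Walk u v) → length (items q) ≡ suc (inner q + inner q)
    length-items (edge e j) = refl
    length-items (step e j q) = cong (2 +_) (trans (length-items q)
        (sym (+-suc (inner q) (inner q))))

    length-rights-items : (q : Walk u v) → length (rights (items q)) ≡ suc (inner q)
    length-rights-items (edge e j) = refl
    length-rights-items (step e j q) = cong suc (length-rights-items q)

    vertexAt : (q : Walk u v) → Fin (inner q) → V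
    vertexAt (step {v = v} _ _ q) zero = v
    vertexAt (step _ _ q) (suc i) = vertexAt q i

    edgeAt : (q : Walk u v) → Fin (suc (inner q)) → E
    edgeAt (edge e _) zero = e
    edgeAt (step e _ q) zero = e
    edgeAt (step e _ q) (suc i) = edgeAt q i

    vertexAt-∈ : (q : Walk u v) (i : Fin (inner q)) → inj₁ (vertexAt q i) ∈ items q
    vertexAt-∈ (step _ _ q) zero = there (here refl)
    vertexAt-∈ (step _ _ q) (suc i) = there (there (vertexAt-∈ q i))

    edgeAt-∈ : (q : Walk u v) (i : Fin (suc (inner q))) → inj₂ (edgeAt q i) ∈ items q
    edgeAt-∈ (edge e _) zero = here refl
    edgeAt-∈ (step e _ q) zero = here refl
    edgeAt-∈ (step e _ q) (suc i) = there (there (edgeAt-∈ q i))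

    ∈-edgeAt : (q : Walk u v) {e : E} → inj₂ e ∈ items q → ∃[ i ] edgeAt q i ≡ e
    ∈-edgeAt (edge e _) (here refl) = zero , refl
    ∈-edgeAt (step e _ q) (here refl) = zero , refl
    ∈-edgeAt (step e _ q) (there (there e∈)) = Product.map suc (λ eq → eq) (∈-edgeAt q e∈)

    vertexAt-injective : (q : Walk u v) → Unique (items q) → Injective _≡_ _≡_ (vertexAt q)
    vertexAt-injective (step _ _ q) _ {zero} {zero} eq = refl
    vertexAt-injective (step _ _ q) (_ ∷ p ∷ _) {zero} {suc j} eq =
        contradiction (cong inj₁ eq) (All.lookup p (vertexAt-∈ q j))
    vertexAt-injective (step _ _ q) (_ ∷ p ∷ _) {suc i} {zero} eq =
        contradiction (cong inj₁ (sym eq)) (All.lookup p (vertexAt-∈ q i))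
    vertexAt-injective (step _ _ q) (_ ∷ _ ∷ u) {suc i} {suc j} eq =
        cong suc (vertexAt-injective q u eq)

    edgeAt-injective : (q : Walk u v) → Unique (items q) → Injective _≡_ _≡_ (edgeAt q)
    edgeAt-injective (edge _ _) _ {zero} {zero} eq = refl
    edgeAt-injective (step _ _ q) _ {zero} {zero} eq = refl
    edgeAt-injective (step _ _ q) ((_ ∷ p) ∷ _) {zero} {suc j} eq =
        contradiction (cong inj₂ eq) (All.lookup p (edgeAt-∈ q j))
    edgeAt-injective (step _ _ q) ((_ ∷ p) ∷ _) {suc i} {zero} eq =
        contradiction (cong inj₂ (sym eq)) (All.lookup p (edgeAt-∈ q i))
    edgeAt-injective (step _ _ q) (_ ∷ _ ∷ u) {suc i} {suc j} eq =
        cong suc (edgeAt-injective q u eq)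

    -- The `cons` and `snoc` form is the one in which `subdivide` lists the ends of its edges, so
    -- that a walk can serve as the image of a subdivided edge.
    edgeAt-joins : (q : Walk u v) (i : Fin (suc (inner q))) →
                   Joins (edgeAt q i) (cons u (vertexAt q) i) (snoc (vertexAt q) v i)
    edgeAt-joins (edge e j) zero = j
    edgeAt-joins (step e j q) zero = j
    edgeAt-joins {u} {v} (step {v = x} e j q) (suc i) =
      subst (λ y → Joins (edgeAt q i) y (snoc (vertexAt q) v i)) (shift i) (edgeAt-joins q i)
      where
      shift : ∀ i → cons x (vertexAt q) i ≡ vertexAt (step {u = u} e j q) i
      shift zero = refl
      shift (suc i) = refl

    -- The converse of reading off `vertexAt` and `edgeAt`. It turns subdivided edges, and cycles
    -- cut open at vertex zero, into walks.
    segment : ∀ {n} (f : Fin n → V) (g : Fin (suc n) → E) →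
              (∀ i → ends (g i) ≡ (cons u f i , snoc f v i)) → Walk u v
    segment {n = zero} f g h = edge (g zero) (inj₁ (h zero))
    segment {n = suc n} f g h = step (g zero) (inj₁ (h zero))
        (segment (f ∘ suc) (g ∘ suc) (λ i → trans (h (suc i))
        (cong (_, snoc (f ∘ suc) _ i) (shift i))))
      where
      shift : ∀ i → f i ≡ cons (f zero) (f ∘ suc) i
      shift zero = refl
      shift (suc i) = refl

    segment-items : ∀ {n} (f : Fin n → V) (g : Fin (suc n) → E)
        (h : ∀ i → ends (g i) ≡ (cons u f i , snoc f v i)) →
      ∀ {y} → y ∈ items (segment f g h) → (∃[ i ] y ≡ inj₁ (f i)) ⊎ (∃[ i ] y ≡ inj₂ (g i))
    segment-items {n = zero} f g h (here eq) = inj₂ (zero , eq)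
    segment-items {n = suc n} f g h (here eq) = inj₂ (zero , eq)
    segment-items {n = suc n} f g h (there (here eq)) = inj₁ (zero , eq)
    segment-items {n = suc n} f g h (there (there y∈)) =
        Sum.map (Product.map suc (λ eq → eq)) (Product.map suc (λ eq → eq))
      (segment-items (f ∘ suc) (g ∘ suc) _ y∈)

    segment-edge-∈ : ∀ {n} (f : Fin n → V) (g : Fin (suc n) → E)
        (h : ∀ i → ends (g i) ≡ (cons u f i , snoc f v i)) →
      inj₂ (g zero) ∈ items (segment f g h)
    segment-edge-∈ {n = zero} f g h = here refl
    segment-edge-∈ {n = suc n} f g h = here refl

    segment-inner : ∀ {n} (f : Fin n → V) (g : Fin (suc n) → E)
        (h : ∀ i → ends (g i) ≡ (cons u f i , snoc f v i)) →
      inner (segment f g h) ≡ n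
    segment-inner {n = zero} f g h = refl
    segment-inner {n = suc n} f g h = cong suc (segment-inner (f ∘ suc) (g ∘ suc) _)

    segment-unique : ∀ {n} (f : Fin n → V) (g : Fin (suc n) → E)
        (h : ∀ i → ends (g i) ≡ (cons u f i , snoc f v i)) →
      Injective _≡_ _≡_ f → Injective _≡_ _≡_ g → Unique (items (segment f g h))
    segment-unique {n = zero} f g h fi gi = [] ∷ []
    segment-unique {n = suc n} f g h fi gi =
      ((λ ()) ∷ All.tabulate λ y∈ eq → first-edge eq (segment-items (f ∘ suc) (g ∘ suc) _ y∈)) ∷
      All.tabulate (λ y∈ eq → first-vertex eq (segment-items (f ∘ suc) (g ∘ suc) _ y∈)) ∷
      segment-unique (f ∘ suc) (g ∘ suc) _ (λ eq → Fin.suc-injective (fi eq))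
          (λ eq → Fin.suc-injective (gi eq))
      where
      first-edge : ∀ {y} → inj₂ (g zero) ≡ y → ¬ ((∃[ i ] y ≡ inj₁ (f (suc i))) ⊎
          (∃[ i ] y ≡ inj₂ (g (suc i))))
      first-edge refl (inj₂ (i , eq)) with () ← gi (inj₂-injective eq)
      first-vertex : ∀ {y} → inj₁ (f zero) ≡ y → ¬
          ((∃[ i ] y ≡ inj₁ (f (suc i))) ⊎ (∃[ i ] y ≡ inj₂ (g (suc i))))
      first-vertex refl (inj₁ (i , eq)) with () ← fi (inj₁-injective eq)

  module _ {A B : Graph} (φ : A ↪ B) where
    private
      module A = Walks A
      module B = Walks B

    mapItem : Graph.V A ⊎ Graph.E A → Graph.V B ⊎ Graph.E B
    mapItem = Sum.map (onV φ) (onE φ)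

    mapItem-injective : ∀ {x y} → mapItem x ≡ mapItem y → x ≡ y
    mapItem-injective {inj₁ x} {inj₁ y} eq = cong inj₁ (injectV φ (inj₁-injective eq))
    mapItem-injective {inj₂ x} {inj₂ y} eq = cong inj₂ (injectE φ (inj₂-injective eq))

    mapJoins : ∀ {e u v} → A.Joins e u v → B.Joins (onE φ e) (onV φ u) (onV φ v)
    mapJoins {e} (inj₁ eq) = Sum.map (λ h → trans h (cong (Product.map (onV φ) (onV φ)) eq))
      (λ h → trans h (cong (Product.swap ∘ Product.map (onV φ) (onV φ)) eq)) (incidence φ e)
    mapJoins {e} (inj₂ eq) = Sum.swap (Sum.map
      (λ h → trans h (cong (Product.map (onV φ) (onV φ)) eq))
      (λ h → trans h (cong (Product.swap ∘ Product.map (onV φ) (onV φ)) eq)) (incidence φ e))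

    mapWalk : ∀ {u v} → A.Walk u v → B.Walk (onV φ u) (onV φ v)
    mapWalk (A.edge e j) = B.edge (onE φ e) (mapJoins j)
    mapWalk (A.step e j q) = B.step (onE φ e) (mapJoins j) (mapWalk q)

    items-mapWalk : ∀ {u v} (q : A.Walk u v) → B.items (mapWalk q) ≡ map mapItem (A.items q)
    items-mapWalk (A.edge e j) = refl
    items-mapWalk (A.step e j q) = cong (λ is → inj₂ (onE φ e) ∷ inj₁ _ ∷ is) (items-mapWalk q)

    inner-mapWalk : ∀ {u v} (q : A.Walk u v) → B.inner (mapWalk q) ≡ A.inner q
    inner-mapWalk (A.edge e j) = refl
    inner-mapWalk (A.step e j q) = cong suc (inner-mapWalk q)

  -- An element is rejected only when it is related to one already chosen, and reflexivity covers
  -- the chosen ones. So every element is charged to a chosen one, and each chosen one is charged at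
  -- most `K` times.
  greedy : {R : X → X → Set} (R? : ∀ x y → Dec (R x y)) (xs : List X) {K : ℕ} →
           (∀ {x} → x ∈ xs → R x x) → (∀ {y} → y ∈ xs → ∑ xs (λ x → ⟦ R? x y ⟧) ≤ K) →
           Σ[ ys ∈ List X ] All (_∈ xs) ys × AllPairs (λ x y → ¬ R x y) ys ×
             length xs ≤ length ys * K
  greedy {X = X} {R = R} R? xs {K} R-refl bound = ys , ys⊆ , apart , count
    where
    choose : List X → List X
    choose [] = []
    choose (x ∷ zs) with Any.any? (R? x) (choose zs)
    ... | yes _ = choose zs
    ... | no _ = x ∷ choose zs
    choose-⊆ : ∀ zs → All (_∈ zs) (choose zs)
    choose-⊆ [] = []
    choose-⊆ (x ∷ zs) with Any.any? (R? x) (choose zs)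
    ... | yes _ = All.map there (choose-⊆ zs)
    ... | no _ = here refl ∷ All.map there (choose-⊆ zs)
    choose-apart : ∀ zs → AllPairs (λ x y → ¬ R x y) (choose zs)
    choose-apart [] = []
    choose-apart (x ∷ zs) with Any.any? (R? x) (choose zs)
    ... | yes _ = choose-apart zs
    ... | no none = All.tabulate (λ y∈ r → none (lose y∈ r)) ∷ choose-apart zs
    choose-covers : ∀ zs → (∀ {x} → x ∈ zs → R x x) → ∀ {x} → x ∈ zs → Any (R x) (choose zs)
    choose-covers (z ∷ zs) r x∈ with Any.any? (R? z) (choose zs) | x∈
    ... | yes a | here refl = a
    ... | yes _ | there x∈′ = choose-covers zs (r ∘ there) x∈′
    ... | no _  | here refl = here (r (here refl))
    ... | no _  | there x∈′ = there (choose-covers zs (r ∘ there) x∈′)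
    ys = choose xs
    ys⊆ = choose-⊆ xs
    apart = choose-apart xs
    open ≤-Reasoning
    count : length xs ≤ length ys * K
    count = begin
      length xs ≡⟨ sym (∑-one xs) ⟩
      ∑ xs (λ _ → 1) ≤⟨ ∑-mono xs (λ x x∈ → let y , y∈ , r = find (choose-covers xs R-refl x∈) in
                          ≤-trans (1≤⟦⟧ (R? x y) r) (∈⇒≤∑ (λ y → ⟦ R? x y ⟧) y∈)) ⟩
      ∑ xs (λ x → ∑ ys (λ y → ⟦ R? x y ⟧)) ≡⟨ ∑-swap xs ys _ ⟩
      ∑ ys (λ y → ∑ xs (λ x → ⟦ R? x y ⟧)) ≤⟨ ∑-≤-const ys (λ y y∈ → bound (All.lookup ys⊆ y∈)) ⟩
      length ys * K ∎

  lookup-allPairs : {R : X → X → Set} → (∀ {x y} → R x y → R y x) → {xs : List X} → AllPairs R xs →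
                    ∀ i j → i ≢ j → R (lookup xs i) (lookup xs j)
  lookup-allPairs R-sym (p ∷ ps) zero zero ne = contradiction refl ne
  lookup-allPairs R-sym {x ∷ xs} (p ∷ ps) zero (suc j) ne = All.lookup p (∈-lookup {xs = xs} j)
  lookup-allPairs R-sym {x ∷ xs} (p ∷ ps) (suc i) zero ne =
      R-sym (All.lookup p (∈-lookup {xs = xs} i))
  lookup-allPairs R-sym (p ∷ ps) (suc i) (suc j) ne = lookup-allPairs R-sym ps i j (ne ∘ cong suc)

  cons-map : (h : X → Y) {n : ℕ} {f : Fin n → X} {g : Fin n → Y} {x : X} {y : Y} →
             h x ≡ y → (∀ j → h (f j) ≡ g j) → ∀ i → h (cons x f i) ≡ cons y g i
  cons-map h p q zero = p
  cons-map h p q (suc i) = q i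

  snoc-map : (h : X → Y) {n : ℕ} {f : Fin n → X} {g : Fin n → Y} {x : X} {y : Y} →
             h x ≡ y → (∀ j → h (f j) ≡ g j) → ∀ i → h (snoc f x i) ≡ snoc g y i
  snoc-map h {zero} p q zero = p
  snoc-map h {suc n} p q zero = q zero
  snoc-map h {suc n} p q (suc i) = snoc-map h p (q ∘ suc) i

  -- The first summand counts the arcs passing through a vertex of S; from the others, each of which
  -- meets at most suc (t + t) * M arcs, a disjoint family is chosen greedily.
  densityBound : (t k M : ℕ) → ℕ
  densityBound t k M = M + k * (suc (t + t) * M)

  -- Oriented paths

  module Arcs (G : Multigraph) where
    open Walks (graph G)

    V E Item : Set
    V = Fin (order G)
    E = Fin (size G)
    Item = V ⊎ E

    open DecMem (Fin._≟_ {order G}) using () renaming (_∈?_ to _∈ᵥ?_) public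
    open DecMem (≡-dec (Fin._≟_ {order G}) (Fin._≟_ {size G}))
      using () renaming (_∈?_ to _∈ᵢ?_) public

    record Arc : Set where
      constructor arc
      field
        {src tgt} : V
        walk      : Walk src tgt
    open Arc public

    arcItems : Arc → List Item
    arcItems a = items (walk a)

    flip : Arc → Arc
    flip a = arc (rev (walk a))

    Disjoint : Arc → Arc → Set
    Disjoint a b = ∀ x → x ∈ arcItems a → x ∉ arcItems b

    through : Item → Arc → ℕ
    through x a = ⟦ x ∈ᵢ? arcItems a ⟧

    record Short (t : ℕ) (a : Arc) : Set where
      constructor short
      field
        src≢tgt : src a ≢ tgt a
        unique  : Unique (arcItems a)
        inner≤  : inner (walk a) ≤ t
    open Short public

    -- The ends of the arc belong to `S`, so `avoids` also keeps the arc from revisiting its own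
    -- ends, about which `unique` in `Short` says nothing.
    record Inside (S : List V) (a : Arc) : Set where
      constructor inside-by
      field
        src∈   : src a ∈ S
        tgt∈   : tgt a ∈ S
        avoids : ∀ {x} → x ∈ S → inj₁ x ∉ arcItems a

    module Linkage (t : ℕ) (S : List V) (S! : Unique S) (as : List Arc)
                   (sh : ∀ {a} → a ∈ as → Short t a) (ins : ∀ {a} → a ∈ as → Inside S a)
                   (dis : AllPairs Disjoint as) where
      private
        module I i = Inside (ins (∈-lookup {xs = as} i))
        module S′ i = Short (sh (∈-lookup {xs = as} i))
        at : Fin (length as) → Arc
        at = lookup as

      -- Disjoint arcs with the same ends become parallel edges; this is where the density has to be
      -- that of multigraphs.
      linkage : Multigraph
      linkage = record
        { order = length S
        ; size = length as
        ; ends = λ i → index (I.src∈ i) , index (I.tgt∈ i)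
        ; loopless = λ i eq → S′.src≢tgt i
            (trans (lookup-index (I.src∈ i)) (trans (cong (lookup S) eq)
                (sym (lookup-index (I.tgt∈ i)))))
        }

      private
        s : Fin (length as) → ℕ
        s i = inner (walk (at i))

        φV : Graph.V (subdivide linkage s) → V
        φV (inj₁ x) = lookup S x
        φV (inj₂ (i , j)) = vertexAt (walk (at i)) j

        φE : Graph.E (subdivide linkage s) → E
        φE (i , j) = edgeAt (walk (at i)) j

        apart : ∀ i j → i ≢ j → Disjoint (at i) (at j)
        apart = lookup-allPairs {R = Disjoint} (λ d x x∈ y∈ → d x y∈ x∈) dis

        φV-injective : Injective _≡_ _≡_ φV
        φV-injective {inj₁ x} {inj₁ y} eq = cong inj₁ (lookup-injective S! x y eq)
        φV-injective {inj₁ x} {inj₂ (i , j)} eq = contradiction (vertexAt-∈ (walk (at i)) j)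
          (I.avoids i (subst (_∈ S) eq (∈-lookup {xs = S} x)))
        φV-injective {inj₂ (i , j)} {inj₁ x} eq = contradiction (vertexAt-∈ (walk (at i)) j)
          (I.avoids i (subst (_∈ S) (sym eq) (∈-lookup {xs = S} x)))
        φV-injective {inj₂ (i , j)} {inj₂ (i′ , j′)} eq with i Fin.≟ i′
        ... | yes refl = cong (λ j → inj₂ (i , j))
            (vertexAt-injective (walk (at i)) (S′.unique i) eq)
        ... | no ne = contradiction (subst (λ v → inj₁ v ∈ arcItems (at i′)) (sym eq)
            (vertexAt-∈ (walk (at i′)) j′))
          (apart i i′ ne _ (vertexAt-∈ (walk (at i)) j))

        φE-injective : Injective _≡_ _≡_ φE
        φE-injective {i , j} {i′ , j′} eq with i Fin.≟ i′
        ... | yes refl = cong (i ,_) (edgeAt-injective (walk (at i)) (S′.unique i) eq)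
        ... | no ne = contradiction (subst (λ v → inj₂ v ∈ arcItems (at i′)) (sym eq)
            (edgeAt-∈ (walk (at i′)) j′))
          (apart i i′ ne _ (edgeAt-∈ (walk (at i)) j))

      linkage-minor : ShallowTopMinor t linkage G
      linkage-minor = s , (λ i → S′.inner≤ i) , record
        { onV = φV ; onE = φE ; injectV = φV-injective ; injectE = φE-injective
        ; incidence = λ (i , j) →
            let q = walk (at i)
                l = cons-map φV {f = λ j → inj₂ (i , j)} (sym (lookup-index (I.src∈ i)))
                    (λ _ → refl) j
                r = snoc-map φV {f = λ j → inj₂ (i , j)} (sym (lookup-index (I.tgt∈ i)))
                    (λ _ → refl) j
            in Sum.map (λ h → trans h (sym (cong₂ _,_ l r))) (λ h → trans h (sym (cong₂ _,_ r l)))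
                (edgeAt-joins q j)
        }

    Sparse : ℕ → ℕ → Set
    Sparse t k = ∀ H → ShallowTopMinor t H G → size H ≤ order H * k

    module _ {t k : ℕ} (sparse : Sparse t k) (as : List Arc) (sh : ∀ {a} → a ∈ as → Short t a)
             {M : ℕ} (through≤ : ∀ x → ∑ as (through x) ≤ M) where

      private
        Meets : Arc → Arc → Set
        Meets a b = Any (_∈ arcItems a) (arcItems b)

        meets? : ∀ a b → Dec (Meets a b)
        meets? a b = Any.any? (_∈ᵢ? arcItems a) (arcItems b)

        -- An arc has at most `t` inner vertices and `t + 1` edges, hence at most `2t + 1` items,
        -- each lying on at most `M` arcs.
        K : ℕ
        K = suc (t + t) * M

        meets-self : ∀ a → Meets a a
        meets-self a with walk a
        ... | edge _ _ = here (here refl)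
        ... | step _ _ _ = here (here refl)

        open ≤-Reasoning

        meets≤ : ∀ {b} → b ∈ as → ∑ as (λ a → ⟦ meets? a b ⟧) ≤ K
        meets≤ {b} b∈ = begin
          ∑ as (λ a → ⟦ meets? a b ⟧) ≤⟨ ∑-mono as
              (λ a _ → ⟦⟧-≤ (meets? a b) (λ m → let x , x∈ , x∈a = find m in
            ≤-trans (1≤⟦⟧ (x ∈ᵢ? arcItems a) x∈a) (∈⇒≤∑ (λ x → through x a) x∈))) ⟩
          ∑ as (λ a → ∑ (arcItems b) (λ x → through x a)) ≡⟨ ∑-swap as (arcItems b) _ ⟩
          ∑ (arcItems b) (λ x → ∑ as (through x)) ≤⟨ ∑-≤-const (arcItems b) (λ x _ → through≤ x) ⟩
          length (arcItems b) * M ≡⟨ cong (_* M) (length-items (walk b)) ⟩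
          suc (inner (walk b) + inner (walk b)) * M
              ≤⟨ *-monoˡ-≤ M (s≤s (+-mono-≤ (inner≤ (sh b∈)) (inner≤ (sh b∈)))) ⟩
          K ∎

        Inside? : ∀ S a → Dec ((src a ∈ S × tgt a ∈ S) × All (λ x → inj₁ x ∉ arcItems a) S)
        Inside? S a = ((src a ∈ᵥ? S) ×-dec (tgt a ∈ᵥ? S)) ×-dec
          All.all? (λ x → ¬? (inj₁ x ∈ᵢ? arcItems a)) S

      -- This is the sparseness hypothesis of `Degeneracy.orientation`, which has to hold for every
      -- set of vertices. An arc with both ends in `S` either passes through a vertex of `S` or
      -- satisfies `Inside`.
      inside≤ : ∀ S → Unique S →
        ∑ as (λ a → ⟦ src a ∈ᵥ? S ⟧ * ⟦ tgt a ∈ᵥ? S ⟧) ≤ length S * densityBound t k M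
      inside≤ S S! = begin
        ∑ as (λ a → ⟦ src a ∈ᵥ? S ⟧ * ⟦ tgt a ∈ᵥ? S ⟧) ≤⟨ ∑-mono as (λ a _ → split a) ⟩
        ∑ as (λ a → ∑ S (λ x → through (inj₁ x) a) + ⟦ Inside? S a ⟧) ≡⟨ ∑-+ as _ _ ⟩
        ∑ as (λ a → ∑ S (λ x → through (inj₁ x) a)) + ∑ as (λ a → ⟦ Inside? S a ⟧)
          ≡⟨ cong₂ _+_ (∑-swap as S _) (sym (length-filter-∑ (Inside? S) as)) ⟩
        ∑ S (λ x → ∑ as (through (inj₁ x))) + length bs
            ≤⟨ +-mono-≤ (∑-≤-const S (λ x _ → through≤ (inj₁ x))) bs≤ ⟩
        length S * M + length S * (k * K) ≡⟨ sym (*-distribˡ-+ (length S) M (k * K)) ⟩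
        length S * densityBound t k M ∎
        where
        split : ∀ a →
          ⟦ src a ∈ᵥ? S ⟧ * ⟦ tgt a ∈ᵥ? S ⟧ ≤ ∑ S (λ x → through (inj₁ x) a) + ⟦ Inside? S a ⟧
        split a = ⟦⟧*-≤ (src a ∈ᵥ? S) λ s∈ → ⟦⟧-≤ (tgt a ∈ᵥ? S) λ t∈ →
            found s∈ t∈ (Any.any? (λ x → inj₁ x ∈ᵢ? arcItems a) S)
          where
          found : src a ∈ S → tgt a ∈ S → Dec (Any (λ x → inj₁ x ∈ arcItems a) S) → _
          found s∈ t∈ (yes h) = let x , x∈ , x∈a = find h in
            ≤-trans (1≤⟦⟧ (inj₁ x ∈ᵢ? arcItems a) x∈a) (≤-trans (∈⇒≤∑ (λ x → through (inj₁ x) a) x∈) (m≤m+n _ _))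
          found s∈ t∈ (no none) = ≤-trans (1≤⟦⟧ (Inside? S a) ((s∈ , t∈) , All.¬Any⇒All¬ S none))
              (m≤n+m _ _)
        bs = filter (Inside? S) as
        bs⊆ : ∀ {b} → b ∈ bs → b ∈ as
        bs⊆ = proj₁ ∘ ∈-filter⁻ (Inside? S)
        bs≤ : length bs ≤ length S * (k * K)
        bs≤ = begin
          length bs ≤⟨ proj₂ (proj₂ (proj₂ family)) ⟩
          length cs * K ≤⟨ *-monoˡ-≤ K (sparse L.linkage L.linkage-minor) ⟩
          length S * k * K ≡⟨ *-assoc (length S) k K ⟩
          length S * (k * K) ∎
          where
          family = greedy meets? bs (λ {a} _ → meets-self a) (λ {b} b∈ →
            ≤-trans (≤-reflexive (∑-filter (Inside? S) as _))
              (≤-trans (∑-mono as (λ a _ → ⟦⟧*-≤ (Inside? S a) (λ _ → ≤-refl))) (meets≤ (bs⊆ b∈))))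
          cs = proj₁ family
          cs⊆ : ∀ {c} → c ∈ cs → c ∈ bs
          cs⊆ = All.lookup (proj₁ (proj₂ family))
          cs-short : ∀ {c} → c ∈ cs → Short t c
          cs-short c∈ = sh (bs⊆ (cs⊆ c∈))
          cs-inside : ∀ {c} → c ∈ cs → Inside S c
          cs-inside c∈ with (s∈ , t∈) , av ← proj₂ (∈-filter⁻ (Inside? S) {xs = as} (cs⊆ c∈)) =
            inside-by s∈ t∈ (All.lookup av)
          cs-disjoint : AllPairs Disjoint cs
          cs-disjoint = AllPairs.map (λ nm x x∈ y∈ → nm (lose y∈ x∈)) (proj₁ (proj₂ (proj₂ family)))
          module L = Linkage t S S! cs cs-short cs-inside cs-disjoint

  -- Fraternal augmentation

  ∑-pairs : {A : Set} (xs : List A) (h : A → A → ℕ) (f g : A → ℕ) {D M N : ℕ} →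
    (∀ x → ∑ xs (h x) ≤ D) → (∀ y → ∑ xs (λ x → h x y) ≤ D) → ∑ xs f ≤ M → ∑ xs g ≤ N →
    ∑ xs (λ x → ∑ xs (λ y → h x y * (f x + g y))) ≤ D * M + D * N
  ∑-pairs xs h f g {D} {M} {N} row col f≤ g≤ = begin
    ∑ xs (λ x → ∑ xs (λ y → h x y * (f x + g y)))
      ≡⟨ ∑-cong xs (λ x → ∑-cong xs (λ y → *-distribˡ-+ (h x y) (f x) (g y))) ⟩
    ∑ xs (λ x → ∑ xs (λ y → h x y * f x + h x y * g y))
      ≡⟨ ∑-cong xs (λ x → ∑-+ xs (λ y → h x y * f x) (λ y → h x y * g y)) ⟩
    ∑ xs (λ x → ∑ xs (λ y → h x y * f x) + ∑ xs (λ y → h x y * g y))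
      ≡⟨ ∑-+ xs (λ x → ∑ xs (λ y → h x y * f x)) (λ x → ∑ xs (λ y → h x y * g y)) ⟩
    ∑ xs (λ x → ∑ xs (λ y → h x y * f x)) + ∑ xs (λ x → ∑ xs (λ y → h x y * g y))
      ≡⟨ cong (∑ xs (λ x → ∑ xs (λ y → h x y * f x)) +_) (∑-swap xs xs (λ x y → h x y * g y)) ⟩
    ∑ xs (λ x → ∑ xs (λ y → h x y * f x)) + ∑ xs (λ y → ∑ xs (λ x → h x y * g y))
      ≤⟨ +-mono-≤ (weighted (λ x y → h x y) f row f≤) (weighted (λ y x → h x y) g col g≤) ⟩
    D * M + D * N ∎
    where
    open ≤-Reasoning
    -- The weight of an element is counted once for each of its at most `D` partners. Rows give this
    -- for the first member of a pair and columns for the second.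
    weighted : ∀ (h′ : _ → _ → ℕ) f′ {M′} → (∀ x → ∑ xs (h′ x) ≤ D) → ∑ xs f′ ≤ M′ →
               ∑ xs (λ x → ∑ xs (λ y → h′ x y * f′ x)) ≤ D * M′
    weighted h′ f′ r f′≤ = ≤-trans
      (∑-mono xs (λ x _ → ≤-trans (≤-reflexive (∑-*ʳ xs (h′ x) (f′ x))) (*-monoˡ-≤ (f′ x) (r x))))
      (≤-trans (≤-reflexive (∑-*ˡ xs f′ D)) (*-monoʳ-≤ D f′≤))

  -- An item of a concatenation q ∙ rev r lies on q, or is the common head of q and r, or lies on r.
  throughBound : (D M : ℕ) → ℕ
  throughBound D M = D * (M + D) + D * M

  module Augment (G : Multigraph) {t k : ℕ} (sparse : Arcs.Sparse G t k) where
    open Walks (graph G)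
    open Arcs G

    _≟ᵥ_ : DecidableEquality V
    _≟ᵥ_ = Fin._≟_

    _≟ᵢ_ : DecidableEquality Item
    _≟ᵢ_ = ≡-dec Fin._≟_ Fin._≟_

    indegree : List Arc → V → ℕ
    indegree as v = ∑ as (λ a → ⟦ tgt a ≟ᵥ v ⟧)

    _∈±_ : Arc → List Arc → Set
    a ∈± as = a ∈ as ⊎ flip a ∈ as

    -- `∈-arcs⁻` retains only the number of inner vertices of the arc before reversal: this is all
    -- that is needed to recognise a new arc as too long to be part of a merge in the same round.
    record Oriented (as : List Arc) (D M : ℕ) : Set where
      field
        arcs       : List Arc
        ∈-arcs⁺    : ∀ {a} → a ∈ as → a ∈± arcs
        ∈-arcs⁻    : ∀ {b} → b ∈ arcs → ∃[ a ] a ∈ as × inner (walk b) ≡ inner (walk a)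
        short-arcs : ∀ {b} → b ∈ arcs → Short t b
        indegree≤  : ∀ v → indegree arcs v ≤ D
        through≤   : ∀ x → ∑ arcs (through x) ≤ M

    flip-items⁻ : ∀ a {x} → x ∈ arcItems (flip a) → x ∈ arcItems a
    flip-items⁻ a x∈ = reverse⁻ (subst (_ ∈_) (items-rev (walk a)) x∈)

    flip-short : ∀ {a} → Short t a → Short t (flip a)
    flip-short {a} (short ne u le) = short (ne ∘ sym)
        (subst Unique (sym (items-rev (walk a))) (unique-reverse u))
      (≤-trans (≤-reflexive (inner-rev (walk a))) le)

    module Reorient (b : Arc → Bool) (as : List Arc) (sh : ∀ {a} → a ∈ as → Short t a) {D M : ℕ}
                    (indeg : ∀ v → ∑ as (λ a → ⟦ (if b a then src a else tgt a) ≟ᵥ v ⟧) ≤ D)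
                    (thr : ∀ x → ∑ as (through x) ≤ M) where
      o : Arc → Arc
      -- `b a` says that the end `src a` is to be the head, whereas an arc always points to its
      -- `tgt`.
      o a = if b a then flip a else a

      ∈-o : ∀ {a as} → o a ∈ as → a ∈± as
      ∈-o {a} oa∈ with b a
      ... | true = inj₂ oa∈
      ... | false = inj₁ oa∈

      inner-o : ∀ a → inner (walk (o a)) ≡ inner (walk a)
      inner-o a with b a
      ... | true = inner-rev (walk a)
      ... | false = refl

      short-o : ∀ a → Short t a → Short t (o a)
      short-o a s with b a
      ... | true = flip-short s
      ... | false = s

      through-o : ∀ x a → through x (o a) ≤ through x a
      through-o x a with b a
      ... | true = ⟦⟧-mono (x ∈ᵢ? arcItems (flip a)) (x ∈ᵢ? arcItems a) (flip-items⁻ a)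
      ... | false = ≤-refl

      tgt-o : ∀ a → tgt (o a) ≡ (if b a then src a else tgt a)
      tgt-o a with b a
      ... | true = refl
      ... | false = refl

      reorient : Oriented as D M
      reorient = record
        { arcs = map o as
        ; ∈-arcs⁺ = λ a∈ → ∈-o (∈-map⁺ o a∈)
        ; ∈-arcs⁻ = λ b∈ → let a , a∈ , eq = ∈-map⁻ o b∈ in a , a∈ , trans (cong (inner ∘ walk) eq)
            (inner-o a)
        ; short-arcs = λ b∈ → let a , a∈ , eq = ∈-map⁻ o b∈ in subst (Short t) (sym eq)
            (short-o a (sh a∈))
        ; indegree≤ = λ v → ≤-trans (≤-reflexive (∑-map o as _))
            (≤-trans (∑-mono as (λ a _ → ≤-reflexive (cong (λ w → ⟦ w ≟ᵥ v ⟧) (tgt-o a))))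
                (indeg v))
        ; through≤ = λ x → ≤-trans (≤-reflexive (∑-map o as _))
            (≤-trans (∑-mono as (λ a _ → through-o x a)) (thr x))
        }

    orient : (as : List Arc) → (∀ {a} → a ∈ as → Short t a) → ∀ {M} → (∀ x → ∑ as (through x) ≤ M) →
             Oriented as (2 * densityBound t k M) M
    orient as sh {M} thr = Reorient.reorient (proj₁ chosen) as sh (proj₂ chosen) thr
      where
      chosen = Degeneracy.orientation _≟ᵥ_ as src tgt (densityBound t k M)
          (inside≤ sparse as sh thr)
        (λ a∈ → src≢tgt (sh a∈)) (allFin (order G)) (Unique.allFin⁺ _) ∈-allFin

    -- `inner q + suc (inner r)` is the number of inner vertices of `q ∙ rev r`, the extra one being
    -- the common head. So `merge` is vacuous for index 0, and for index `t` it covers all merged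
    -- paths with at most `t + 1 = p` edges.
    record Stage (i D M : ℕ) : Set where
      field
        arcs       : List Arc
        short-arcs : ∀ {a} → a ∈ arcs → Short t a
        indegree≤  : ∀ v → indegree arcs v ≤ D
        through≤   : ∀ x → ∑ arcs (through x) ≤ M
        edges      : ∀ {u v} e (j : Joins e u v) → arc (edge e j) ∈± arcs
        merge      : ∀ {x y z} {q : Walk x z} {r : Walk y z} → arc q ∈ arcs → arc r ∈ arcs →
                     inner q + suc (inner r) ≤ i → x ≢ y → Unique (items (q ∙ rev r)) →
                     arc (q ∙ rev r) ∈± arcs

    module Initial where
      single : E → Arc
      single e = arc (edge e (inj₁ refl))

      singles : List Arc
      singles = map single (allFin (size G))

      single-through : ∀ x → ∑ (allFin (size G)) (through x ∘ single) ≤ 1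
      single-through (inj₁ v) = ≤-trans
        (∑-mono (allFin (size G)) {g = λ _ → 0}
          (λ e _ → ⟦⟧-≤ (inj₁ v ∈ᵢ? arcItems (single e)) λ { (here ()) ; (there ()) }))
        (≤-trans (≤-reflexive (∑-zero (allFin (size G)))) z≤n)
      single-through (inj₂ f) = ≤-trans
        (∑-mono (allFin (size G)) {g = λ e → ⟦ f Fin.≟ e ⟧}
          (λ e _ → ⟦⟧-mono (inj₂ f ∈ᵢ? arcItems (single e)) (f Fin.≟ e)
            λ { (here eq) → inj₂-injective eq }))
        (≤-trans (∑-≟ Fin._≟_ (Unique.allFin⁺ (size G)) f)
            (⟦⟧≤1 (DecMem._∈?_ Fin._≟_ f (allFin (size G)))))

      singles-short : ∀ {a} → a ∈ singles → Short t a
      singles-short a∈ with e , _ , refl ← ∈-map⁻ single a∈ =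
          short (Multigraph.loopless G e) ([] ∷ []) z≤n

      module _ {D M : ℕ} (fresh : Oriented singles D M) where
        open Oriented fresh

        edges′ : ∀ {u v} e (j : Joins e u v) → arc (edge e j) ∈± arcs
        edges′ e (inj₁ refl) = ∈-arcs⁺ (∈-map⁺ single (∈-allFin e))
        edges′ e (inj₂ refl) = Sum.swap (∈-arcs⁺ (∈-map⁺ single (∈-allFin e)))

        start : Stage 0 D M
        start = record
          { arcs = arcs ; short-arcs = short-arcs ; indegree≤ = indegree≤ ; through≤ = through≤
          ; edges = edges′
          ; merge = λ {_} {_} {_} {q} {r} _ _ le → contradiction
              (≤-trans (≤-reflexive (sym (+-suc (inner q) (inner r)))) le) λ ()
          }

      initial : Stage 0 (2 * densityBound t k 1) 1
      initial = start (orient singles singles-short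
          (λ x → ≤-trans (≤-reflexive (∑-map single (allFin _) (through x))) (single-through x)))

    module Join (i : ℕ) where
      join′ : ∀ {x y z} (q : Walk x z) (r : Walk y z) →
              Dec (x ≢ y × Unique (items (q ∙ rev r)) × inner (q ∙ rev r) ≡ suc i) → List Arc
      join′ q r (yes _) = arc (q ∙ rev r) ∷ []
      join′ q r (no _) = []

      Joinable? : ∀ {x y z} (q : Walk x z) (r : Walk y z) →
                  Dec (x ≢ y × Unique (items (q ∙ rev r)) × inner (q ∙ rev r) ≡ suc i)
      Joinable? {x} {y} q r = ¬? (x ≟ᵥ y) ×-dec unique? _≟ᵢ_ (items (q ∙ rev r)) ×-dec
          (inner (q ∙ rev r) ≟ suc i)

      -- At most one arc, as a list for `concatMap`. Merged paths with at most `i` inner vertices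
      -- are present in a stage of index `i`, so only those with exactly `suc i` are made.
      join : Arc → Arc → List Arc
      join (arc {tgt = z} q) (arc {tgt = z′} r) with z′ ≟ᵥ z
      ... | yes refl = join′ q r (Joinable? q r)
      ... | no _ = []

      join-short : suc i ≤ t → ∀ a b {c} → c ∈ join a b → Short t c × inner (walk c) ≡ suc i
      join-short le (arc {tgt = z} q) (arc {tgt = z′} r) c∈ with z′ ≟ᵥ z
      ... | yes refl with Joinable? q r | c∈
      ... | yes (ne , u , eq) | here refl = short ne u (≤-trans (≤-reflexive eq) le) , eq

      join-∈ : ∀ {x y z} (q : Walk x z) (r : Walk y z) → x ≢ y → Unique (items (q ∙ rev r)) →
               inner (q ∙ rev r) ≡ suc i → arc (q ∙ rev r) ∈ join (arc q) (arc r)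
      join-∈ {z = z} q r ne u eq with z ≟ᵥ z
      ... | no z≢z = contradiction refl z≢z
      ... | yes refl with Joinable? q r
      ... | yes _ = here refl
      ... | no no! = contradiction (ne , u , eq) no!

      join-through : ∀ x a b → ∑ (join a b) (through x) ≤
        ⟦ tgt b ≟ᵥ tgt a ⟧ * ((through x a + ⟦ inj₁ (tgt a) ≟ᵢ x ⟧) + through x b)
      join-through x (arc {tgt = z} q) (arc {tgt = z′} r) with z′ ≟ᵥ z
      ... | no _ = z≤n
      ... | yes refl with Joinable? q r
      ... | no _ = z≤n
      ... | yes _ = ≤-trans (≤-reflexive (+-identityʳ _))
          (≤-trans (⟦⟧-≤ (x ∈ᵢ? items (q ∙ rev r)) (λ x∈ →
          at (∈-++⁻ (items q) (subst (x ∈_) (items-∙ q (rev r)) x∈))))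
              (≤-reflexive (sym (+-identityʳ _))))
        where
        at : x ∈ items q ⊎ x ∈ inj₁ z ∷ items (rev r) →
             1 ≤ (through x (arc q) + ⟦ inj₁ z ≟ᵢ x ⟧) + through x (arc r)
        at (inj₁ x∈) = ≤-trans (1≤⟦⟧ (x ∈ᵢ? items q) x∈) (≤-trans (m≤m+n _ _) (m≤m+n _ _))
        at (inj₂ (here eq)) = ≤-trans (1≤⟦⟧ (inj₁ z ≟ᵢ x) (sym eq))
            (≤-trans (m≤n+m _ (through x (arc q))) (m≤m+n _ _))
        at (inj₂ (there x∈)) = ≤-trans (1≤⟦⟧ (x ∈ᵢ? items r) (flip-items⁻ (arc r) x∈))
            (m≤n+m _ (through x (arc q) + ⟦ inj₁ z ≟ᵢ x ⟧))

    module Step {i D M : ℕ} (i<t : suc i ≤ t) (st : Stage i D M) where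
      private module old = Stage st
      open Join i

      cands : List Arc
      cands = concatMap (λ a → concatMap (join a) old.arcs) old.arcs

      cands⁻ : ∀ {c} → c ∈ cands → Short t c × inner (walk c) ≡ suc i
      cands⁻ c∈
        with a , _ , c∈a ← find (∈-concatMap⁻ (λ a → concatMap (join a) old.arcs) {xs = old.arcs} c∈)
        with b , _ , c∈ab ← find (∈-concatMap⁻ (join a) {xs = old.arcs} c∈a) =
        join-short i<t a b c∈ab

      δ : Item → Arc → ℕ
      δ x a = ⟦ inj₁ (tgt a) ≟ᵢ x ⟧

      same : Arc → Arc → ℕ
      same a b = ⟦ tgt b ≟ᵥ tgt a ⟧

      δ≤ : ∀ x → ∑ old.arcs (δ x) ≤ D
      δ≤ (inj₁ v) = ≤-trans (∑-mono old.arcs (λ a _ → ⟦⟧-mono (inj₁ (tgt a) ≟ᵢ inj₁ v) (tgt a ≟ᵥ v)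
          inj₁-injective)) (old.indegree≤ v)
      δ≤ (inj₂ e) = ≤-trans (∑-mono old.arcs (λ a _ → ⟦⟧-≤ (inj₁ (tgt a) ≟ᵢ inj₂ e) λ ()))
          (≤-trans (≤-reflexive (∑-zero old.arcs)) z≤n)

      thr : ∀ x → ∑ cands (through x) ≤ throughBound D M
      thr x = ≤-trans
        (≤-reflexive (trans (∑-concatMap (λ a → concatMap (join a) old.arcs) old.arcs (through x))
          (∑-cong old.arcs (λ a → ∑-concatMap (join a) old.arcs (through x)))))
        (≤-trans (∑-mono old.arcs (λ a _ → ∑-mono old.arcs (λ b _ → join-through x a b)))
          (∑-pairs old.arcs same (λ a → through x a + δ x a) (through x)
            (λ a → old.indegree≤ (tgt a))
            (λ b → ≤-trans (∑-mono old.arcs (λ a _ → ⟦⟧-mono (tgt b ≟ᵥ tgt a) (tgt a ≟ᵥ tgt b)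
                sym)) (old.indegree≤ (tgt b)))
            (≤-trans (≤-reflexive (∑-+ old.arcs (through x) (δ x)))
                (+-mono-≤ (old.through≤ x) (δ≤ x)))
            (old.through≤ x)))

      module _ {D′ M′ : ℕ} (fresh : Oriented cands D′ M′) where
        private module new = Oriented fresh

        weaken : ∀ {a} → a ∈± old.arcs → a ∈± (new.arcs ++ old.arcs)
        weaken = Sum.map (∈-++⁺ʳ new.arcs) (∈-++⁺ʳ new.arcs)

        is-old : ∀ {a} → inner (walk a) ≤ i → a ∈ new.arcs ++ old.arcs → a ∈ old.arcs
        is-old {a} le a∈ with ∈-++⁻ new.arcs a∈
        ... | inj₂ a∈old = a∈old
        ... | inj₁ a∈new with b , b∈ , eq ← new.∈-arcs⁻ a∈new =
          contradiction (≤-trans (≤-reflexive (sym (trans eq (proj₂ (cands⁻ b∈))))) le) 1+n≰n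

        merge′ : ∀ {x y z} {q : Walk x z} {r : Walk y z} →
          arc q ∈ new.arcs ++ old.arcs → arc r ∈ new.arcs ++ old.arcs →
          inner q + suc (inner r) ≤ suc i → x ≢ y → Unique (items (q ∙ rev r)) →
          arc (q ∙ rev r) ∈± (new.arcs ++ old.arcs)
        merge′ {q = q} {r} q∈ r∈ le ne u with inner q + suc (inner r) ≤? i
        ... | yes le′ = weaken (old.merge (is-old le-q q∈) (is-old le-r r∈) le′ ne u)
          where
          le-q = ≤-trans (m≤m+n (inner q) (suc (inner r))) le′
          le-r = ≤-trans (n≤1+n _) (≤-trans (m≤n+m (suc (inner r)) (inner q)) le′)
        ... | no nle = Sum.map ∈-++⁺ˡ ∈-++⁺ˡ (new.∈-arcs⁺
            (∈-concatMap⁺ (λ a → concatMap (join a) old.arcs) {xs = old.arcs} (lose (is-old le-q q∈)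
            (∈-concatMap⁺ (join (arc q)) {xs = old.arcs} (lose (is-old le-r r∈) (join-∈ q r ne u
              (trans (inner-∙ q (rev r)) (trans (cong (λ n → inner q + suc n) (inner-rev r))
                  (≤-antisym le (≰⇒> nle))))))))))
          where
          le-q = s≤s⁻¹ (≤-trans (≤-trans (s≤s (m≤m+n (inner q) (inner r)))
              (≤-reflexive (sym (+-suc (inner q) (inner r))))) le)
          le-r = s≤s⁻¹ (≤-trans (m≤n+m (suc (inner r)) (inner q)) le)

        extend : Stage (suc i) (D′ + D) (M′ + M)
        extend = record
          { arcs = new.arcs ++ old.arcs
          ; short-arcs = λ a∈ → Sum.[ new.short-arcs , old.short-arcs ]′ (∈-++⁻ new.arcs a∈)
          ; indegree≤ = λ v → ≤-trans (≤-reflexive (∑-++ new.arcs old.arcs _))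
              (+-mono-≤ (new.indegree≤ v) (old.indegree≤ v))
          ; through≤ = λ x → ≤-trans (≤-reflexive (∑-++ new.arcs old.arcs _))
              (+-mono-≤ (new.through≤ x) (old.through≤ x))
          ; edges = λ e j → weaken (old.edges e j)
          ; merge = merge′
          }

      next : Stage (suc i) (2 * densityBound t k (throughBound D M) + D) (throughBound D M + M)
      next = extend (orient cands (proj₁ ∘ cands⁻) thr)

  -- Colouring

  ≤countDistinct : ∀ {n k} {X : Set} (f : Fin n → X) (c : X → Fin k) (xs : List X) →
                   (∀ {x} → x ∈ xs → ∃[ i ] f i ≡ x) → Unique (map c xs) →
                   length xs ≤ countDistinct (c ∘ f)
  ≤countDistinct f c xs cover u = ≤-trans (≤-reflexive (sym (length-map c xs)))
    (unique-⊆⇒length≤ u λ y∈ → let x , x∈ , eq = ∈-map⁻ c y∈ ; i , fi = cover x∈ in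
      ∈-deduplicate⁺ Fin._≟_ (subst (_∈ tabulate (c ∘ f)) (trans (cong c fi) (sym eq))
          (∈-tabulate⁺ i)))

  countDistinct≤ : ∀ {n m k} (f : Fin n → Fin k) (g : Fin m → Fin k) →
                   (∀ i → ∃[ j ] f i ≡ g j) → countDistinct f ≤ m
  countDistinct≤ f g cover = ≤-trans
    (unique-⊆⇒length≤ {ys = tabulate g} (deduplicate-! Fin._≟_ (tabulate f)) λ y∈ →
      let i , eq = ∈-tabulate⁻ (∈-deduplicate⁻ Fin._≟_ (tabulate f) y∈) ; j , fj = cover i in
      subst (_∈ tabulate g) (sym (trans eq fj)) (∈-tabulate⁺ j))
    (≤-reflexive (length-tabulate g))

  reachBound : (t D n : ℕ) → ℕ
  reachBound t D zero = D * suc t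
  reachBound t D (suc n) = D * suc t + D * reachBound t D n

  module Ancestors (G : Multigraph) {t k : ℕ} (sparse : Arcs.Sparse G t k)
                   {D M : ℕ} (st : Augment.Stage G sparse t D M) where
    open Walks (graph G)
    open Arcs G
    open Augment G sparse
    open Stage st

    arcEdges : Arc → List E
    arcEdges a = rights (arcItems a)

    into? : ∀ z a → Dec (tgt a ≡ z)
    into? z a = tgt a ≟ᵥ z

    into : V → List Arc
    into z = filter (into? z) arcs

    -- The edges seen from `z` by going back along at most `n` arcs and then looking at the arcs
    -- into the vertex reached. Arcs are only followed from head to tail, so the in-degree bounds
    -- the length.
    reach : ℕ → V → List E
    reach zero z = concatMap arcEdges (into z)
    reach (suc n) z = concatMap arcEdges (into z) ++ concatMap (reach n ∘ src) (into z)

    ∑-into : ∀ z {f : Arc → ℕ} {c} → (∀ a → a ∈ arcs → f a ≤ c) → ∑ (into z) f ≤ D * c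
    ∑-into z {f} {c} h = ≤-trans (∑-≤-const (into z)
        (λ a a∈ → h a (proj₁ (∈-filter⁻ (into? z) a∈))))
      (*-monoˡ-≤ c (≤-trans (≤-reflexive (length-filter-∑ (into? z) arcs)) (indegree≤ z)))

    length-arcEdges : ∀ a → a ∈ arcs → length (arcEdges a) ≤ suc t
    length-arcEdges a a∈ = ≤-trans (≤-reflexive (length-rights-items (walk a)))
        (s≤s (inner≤ (short-arcs a∈)))

    length-near : ∀ z → length (concatMap arcEdges (into z)) ≤ D * suc t
    length-near z = ≤-trans (≤-reflexive (length-concatMap arcEdges (into z)))
        (∑-into z length-arcEdges)

    length-reach : ∀ n z → length (reach n z) ≤ reachBound t D n
    length-reach zero z = length-near z
    length-reach (suc n) z = ≤-trans (≤-reflexive (length-++ (concatMap arcEdges (into z))))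
        (+-mono-≤ (length-near z)
      (≤-trans (≤-reflexive (length-concatMap (reach n ∘ src) (into z)))
          (∑-into z (λ a _ → length-reach n (src a)))))

    ∈-near : ∀ {a f} → a ∈ arcs → f ∈ arcEdges a → f ∈ concatMap arcEdges (into (tgt a))
    ∈-near {a} a∈ f∈ = ∈-concatMap⁺ arcEdges {xs = into (tgt a)}
        (lose (∈-filter⁺ (into? (tgt a)) a∈ refl) f∈)

    near⊆reach : ∀ n z {f} → f ∈ concatMap arcEdges (into z) → f ∈ reach n z
    near⊆reach zero z f∈ = f∈
    near⊆reach (suc n) z f∈ = ∈-++⁺ˡ f∈

    reach-step : ∀ n {a f} → a ∈ arcs → f ∈ reach n (src a) → f ∈ reach (suc n) (tgt a)
    reach-step n {a} a∈ f∈ = ∈-++⁺ʳ (concatMap arcEdges (into (tgt a)))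
      (∈-concatMap⁺ (reach n ∘ src) {xs = into (tgt a)}
          (lose (∈-filter⁺ (into? (tgt a)) a∈ refl) f∈))

    reach-mono : ∀ {m n} z → m ≤ n → ∀ {f} → f ∈ reach m z → f ∈ reach n z
    reach-mono {zero} {n} z le f∈ = near⊆reach n z f∈
    reach-mono {suc m} {suc n} z (s≤s le) f∈ with ∈-++⁻ (concatMap arcEdges (into z)) f∈
    ... | inj₁ f∈near = ∈-++⁺ˡ f∈near
    ... | inj₂ f∈far with a , a∈ , f∈a ← find (∈-concatMap⁻ (reach m ∘ src) {xs = into z} f∈far) =
      ∈-++⁺ʳ (concatMap arcEdges (into z)) (∈-concatMap⁺ (reach n ∘ src) {xs = into z}
          (lose a∈ (reach-mono (src a) le f∈a)))

    -- This is `p + 1`, the number of colours required on a long cycle.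
    depth : ℕ
    depth = 2 + t

    on? : ∀ f a → Dec (inj₂ f ∈ arcItems a)
    on? f a = inj₂ f ∈ᵢ? arcItems a

    conflicts : E → List E
    conflicts f = concatMap (reach depth ∘ tgt) (filter (on? f) arcs)

    conflictBound : ℕ
    conflictBound = M * reachBound t D depth

    length-conflicts : ∀ f → length (conflicts f) ≤ conflictBound
    length-conflicts f = ≤-trans (≤-reflexive (length-concatMap (reach depth ∘ tgt)
        (filter (on? f) arcs)))
      (≤-trans (∑-≤-const (filter (on? f) arcs) (λ a _ → length-reach depth (tgt a)))
        (*-monoˡ-≤ (reachBound t D depth) (≤-trans (≤-reflexive (length-filter-∑ (on? f) arcs))
            (through≤ (inj₂ f)))))

    pairsOf : E → List (E × E)
    pairsOf f = map (f ,_) (conflicts f)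

    pairs : List (E × E)
    pairs = concatMap pairsOf (allFin (size G))

    open DecMem (Fin._≟_ {size G}) using () renaming (_∈?_ to _∈ₑ?_)

    ∑-∈? : ∀ S → ∑ (allFin (size G)) (λ f → ⟦ f ∈ₑ? S ⟧) ≤ length S * 1
    ∑-∈? S = ≤-trans (∑-mono (allFin (size G)) {g = λ f → ∑ S (λ y → ⟦ y Fin.≟ f ⟧)}
        (λ f _ → ⟦⟧-≤ (f ∈ₑ? S) λ f∈ → ≤-trans (1≤⟦⟧ (f Fin.≟ f) refl)
            (∈⇒≤∑ (λ y → ⟦ y Fin.≟ f ⟧) f∈)))
      (≤-trans (≤-reflexive (∑-swap (allFin (size G)) S (λ f y → ⟦ y Fin.≟ f ⟧)))
        (∑-≤-const S (λ y _ → ≤-trans (∑-≟ Fin._≟_ (Unique.allFin⁺ (size G)) y)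
            (⟦⟧≤1 (y ∈ₑ? allFin (size G))))))

    -- Only the number of pairs with a given first component is bounded; no bound is claimed for the
    -- number with a given second one. Summing over the first components in `S` still gives the
    -- sparseness that a degenerate order requires.
    pairs-sparse : ∀ S → Unique S →
      ∑ pairs (λ ff → ⟦ proj₁ ff ∈ₑ? S ⟧ * ⟦ proj₂ ff ∈ₑ? S ⟧) ≤ length S * conflictBound
    pairs-sparse S _ = begin
      ∑ pairs ins ≡⟨ ∑-concatMap pairsOf (allFin (size G)) ins ⟩
      ∑ (allFin (size G)) (λ f → ∑ (pairsOf f) ins) ≤⟨ ∑-mono (allFin (size G)) (λ f _ → at f) ⟩
      ∑ (allFin (size G)) (λ f → ⟦ f ∈ₑ? S ⟧ * conflictBound)
          ≡⟨ ∑-*ʳ (allFin (size G)) (λ f → ⟦ f ∈ₑ? S ⟧) conflictBound ⟩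
      ∑ (allFin (size G)) (λ f → ⟦ f ∈ₑ? S ⟧) * conflictBound ≤⟨ *-monoˡ-≤ conflictBound (∑-∈? S) ⟩
      length S * 1 * conflictBound ≡⟨ cong (_* conflictBound) (*-identityʳ (length S)) ⟩
      length S * conflictBound ∎
      where
      open ≤-Reasoning
      ins : E × E → ℕ
      ins ff = ⟦ proj₁ ff ∈ₑ? S ⟧ * ⟦ proj₂ ff ∈ₑ? S ⟧
      at : ∀ f → ∑ (pairsOf f) ins ≤ ⟦ f ∈ₑ? S ⟧ * conflictBound
      at f = begin
        ∑ (pairsOf f) ins ≡⟨ ∑-map (f ,_) (conflicts f) ins ⟩
        ∑ (conflicts f) (λ g → ⟦ f ∈ₑ? S ⟧ * ⟦ g ∈ₑ? S ⟧)
            ≡⟨ ∑-*ˡ (conflicts f) (λ g → ⟦ g ∈ₑ? S ⟧) ⟦ f ∈ₑ? S ⟧ ⟩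
        ⟦ f ∈ₑ? S ⟧ * ∑ (conflicts f) (λ g → ⟦ g ∈ₑ? S ⟧) ≤⟨ *-monoʳ-≤ ⟦ f ∈ₑ? S ⟧ (≤-trans
          (∑-mono (conflicts f) {g = λ _ → 1} (λ g _ → ⟦⟧≤1 (g ∈ₑ? S)))
              (≤-trans (≤-reflexive (∑-one (conflicts f))) (length-conflicts f))) ⟩
        ⟦ f ∈ₑ? S ⟧ * conflictBound ∎

    Good : {K : ℕ} → (E → Fin K) → Set
    Good c = ∀ {a f g} → a ∈ arcs → f ∈ arcEdges a → g ∈ reach depth (tgt a) → f ≢ g → c f ≢ c g

    good-colouring : Σ[ c ∈ (E → Fin (suc (2 * conflictBound))) ] Good c
    good-colouring with c , proper ← Degeneracy.proper-colouring Fin._≟_ pairs proj₁ proj₂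
        conflictBound pairs-sparse
                                       (allFin (size G)) (Unique.allFin⁺ (size G)) ∈-allFin =
      c , λ {a} {f} {g} a∈ f∈ g∈ ne → proper {f , g}
          (∈-concatMap⁺ pairsOf {xs = allFin (size G)} (lose (∈-allFin f) (∈-map⁺ (f ,_)
        (∈-concatMap⁺ (reach depth ∘ tgt) {xs = filter (on? f) arcs}
            (lose (∈-filter⁺ (on? f) a∈ (∈-rights⁻ f∈)) g∈))))) ne

    -- Rainbow edges on closed chains of arcs

    module Rainbows {K : ℕ} (c : E → Fin K) (good : Good c) where

      private variable
        x y z : V

      Distinct : List E → Set
      Distinct = AllPairs (λ f g → c f ≢ c g)

      infixr 5 _∷_

      data Chain : V → V → Set where
        []  : Chain x x
        _∷_ : Σ[ q ∈ Walk x y ] arc q ∈± arcs → Chain y z → Chain x z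

      total : Chain x y → List Item
      total [] = []
      total (_∷_ {y = y} (q , _) ch) = items q ++ inj₁ y ∷ total ch

      links : Chain x y → ℕ
      links [] = 0
      links (_ ∷ ch) = suc (links ch)

      _⧺_ : Chain x y → Chain y z → Chain x z
      [] ⧺ ch = ch
      (l ∷ ch) ⧺ ch′ = l ∷ (ch ⧺ ch′)

      total-⧺ : (ch : Chain x y) (ch′ : Chain y z) → total (ch ⧺ ch′) ≡ total ch ++ total ch′
      total-⧺ [] ch′ = refl
      total-⧺ (_∷_ {y = y} (q , _) ch) ch′ = trans
          (cong (λ is → items q ++ inj₁ y ∷ is) (total-⧺ ch ch′))
        (sym (++-assoc (items q) (inj₁ y ∷ total ch) (total ch′)))

      links-⧺ : (ch : Chain x y) (ch′ : Chain y z) → links (ch ⧺ ch′) ≡ links ch + links ch′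
      links-⧺ [] ch′ = refl
      links-⧺ (l ∷ ch) ch′ = cong suc (links-⧺ ch ch′)

      end-∈ : (ch : Chain x y) → 1 ≤ links ch → inj₁ y ∈ total ch
      end-∈ ((q , _) ∷ []) _ = ∈-++⁺ʳ (items q) (here refl)
      end-∈ ((q , _) ∷ ch@(_ ∷ _)) _ = ∈-++⁺ʳ (items q) (there (end-∈ ch (s≤s z≤n)))

      Forward Backward : Chain x y → Set
      Forward [] = ⊤
      Forward ((q , _) ∷ ch) = arc q ∈ arcs × Forward ch
      Backward [] = ⊤
      Backward ((q , _) ∷ ch) = arc (rev q) ∈ arcs × Backward ch

      -- The number counts links, not edges. As every link has an edge, `n` links carry at least `n`
      -- edges unless the chain ends before.
      firstEdges : ℕ → Chain x y → List E
      firstEdges zero ch = []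
      firstEdges (suc n) [] = []
      firstEdges (suc n) ((q , _) ∷ ch) = rights (items q) ++ firstEdges n ch

      rights-total : (l : Σ[ q ∈ Walk x y ] arc q ∈± arcs) (ch : Chain y z) →
                     rights (total (l ∷ ch)) ≡ rights (items (proj₁ l)) ++ rights (total ch)
      rights-total {y = y} (q , _) ch = rights-++ (items q) (inj₁ y ∷ total ch)

      firstEdges-prefix : ∀ n (ch : Chain x y) → ∃[ fs ] rights (total ch) ≡ firstEdges n ch ++ fs
      firstEdges-prefix zero ch = _ , refl
      firstEdges-prefix (suc n) [] = _ , refl
      firstEdges-prefix (suc n) (l@(q , _) ∷ ch) with fs , eq ← firstEdges-prefix n ch =
        fs , trans (rights-total l ch) (trans (cong (rights (items q) ++_) eq)
            (sym (++-assoc (rights (items q)) _ fs)))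

      length-firstEdges : ∀ n (ch : Chain x y) →
                          length (rights (total ch)) ⊓ n ≤ length (firstEdges n ch)
      length-firstEdges zero ch = ≤-reflexive (⊓-zeroʳ (length (rights (total ch))))
      length-firstEdges (suc n) [] = z≤n
      length-firstEdges (suc n) (l@(q , _) ∷ ch) = begin
        length (rights (total (l ∷ ch))) ⊓ suc n ≡⟨ cong (_⊓ suc n)
            (trans (cong length (rights-total l ch)) (length-++ (rights (items q)))) ⟩
        (length (rights (items q)) + length (rights (total ch))) ⊓ suc n
          ≤⟨ ⊓-monoʳ-≤ (length (rights (items q)) + length (rights (total ch)))
              (+-monoˡ-≤ n (≤-trans (s≤s z≤n) (≤-reflexive (sym (length-rights-items q))))) ⟩
        (length (rights (items q)) + length (rights (total ch))) ⊓ (length (rights (items q)) + n)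
          ≡⟨ sym (+-distribˡ-⊓ (length (rights (items q))) (length (rights (total ch))) n) ⟩
        length (rights (items q)) + (length (rights (total ch)) ⊓ n)
            ≤⟨ +-monoʳ-≤ (length (rights (items q))) (length-firstEdges n ch) ⟩
        length (rights (items q)) + length (firstEdges n ch) ≡⟨ sym (length-++ (rights (items q))) ⟩
        length (firstEdges (suc n) (l ∷ ch)) ∎
        where open ≤-Reasoning

      -- Two edges on arcs with the common head `z` conflict already at distance zero in `reach`.
      near-distinct : ∀ z {fs} → Unique fs →
        (∀ {f} → f ∈ fs → ∃[ a ] a ∈ arcs × tgt a ≡ z × f ∈ arcEdges a) → Distinct fs
      near-distinct z [] h = []
      near-distinct z {f ∷ fs} (p ∷ u) h =
        All.tabulate (λ g∈ → apart (h (here refl)) (h (there g∈)) (All.lookup p g∈)) ∷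
        near-distinct z u (h ∘ there)
        where
        apart : ∀ {f g} → ∃[ a ] a ∈ arcs × tgt a ≡ z × f ∈ arcEdges a →
            ∃[ a ] a ∈ arcs × tgt a ≡ z × g ∈ arcEdges a → f ≢ g → c f ≢ c g
        apart (a , a∈ , refl , f∈) (b , b∈ , eq , g∈) ne = good a∈ f∈
          (near⊆reach depth _ (subst (λ z → _ ∈ concatMap arcEdges (into z)) eq (∈-near b∈ g∈))) ne

      rev-edges : (q : Walk x y) {f : E} → f ∈ rights (items q) → f ∈ arcEdges (arc (rev q))
      rev-edges q f∈ = ∈-rights⁺ (subst (_ ∈_) (sym (items-rev q))
          (reverse⁺ (∈-rights⁻ {xs = items q} f∈)))

      -- Along forward links an edge left behind remains visible from the current vertex, one level
      -- deeper per link. The level is `m` now and at most `n + m` after the links still to be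
      -- crossed, so it never exceeds `depth`.
      forward-apart : ∀ n m (ch : Chain x y) → Forward ch → n + m ≤ depth →
        ∀ {f g} → f ∈ reach m x → g ∈ firstEdges n ch → f ≢ g → c f ≢ c g
      forward-apart (suc n) m ((q , _) ∷ ch) (q∈ , fw) le f∈ g∈ ne with ∈-++⁻ (rights (items q)) g∈
      ... | inj₁ g∈q = good q∈ g∈q (reach-mono _ (≤-trans (s≤s (m≤n+m m n)) le)
          (reach-step m q∈ f∈)) (ne ∘ sym) ∘ sym
      ... | inj₂ g∈ch = forward-apart n (suc m) ch fw (≤-trans (≤-reflexive (+-suc n m)) le)
          (reach-step m q∈ f∈) g∈ch ne

      forward-distinct : ∀ n (ch : Chain x y) → Forward ch → n ≤ depth →
        Unique (firstEdges n ch) → Distinct (firstEdges n ch)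
      forward-distinct zero ch fw le u = []
      forward-distinct (suc n) [] fw le u = []
      forward-distinct (suc n) (_∷_ {y = y} (q , _) ch) (q∈ , fw) le u
        with uq , uc , dis ← unique-++⁻ (rights (items q)) u = AllPairs.++⁺
        (near-distinct y uq (λ f∈ → arc q , q∈ , refl , f∈))
        (forward-distinct n ch fw (≤-trans (n≤1+n n) le) uc)
        (All.tabulate λ f∈ → All.tabulate λ g∈ → forward-apart n 0 ch fw
            (≤-trans (≤-reflexive (+-identityʳ n)) (≤-trans (n≤1+n n) le))
          (∈-near q∈ f∈) g∈ λ { refl → dis f∈ g∈ })

      -- Backward links lead from a vertex to its in-neighbours, so here the later edges are the
      -- ancestors, and all of them are seen from the start of the chain.
      backward-reach : ∀ n (ch : Chain x y) → Backward ch →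
        ∀ {g} → g ∈ firstEdges n ch → g ∈ reach n x
      backward-reach (suc n) ((q , _) ∷ ch) (q∈ , bw) g∈ with ∈-++⁻ (rights (items q)) g∈
      ... | inj₁ g∈q = near⊆reach (suc n) _ (∈-near q∈ (rev-edges q g∈q))
      ... | inj₂ g∈ch = reach-step n q∈ (backward-reach n ch bw g∈ch)

      backward-distinct : ∀ n (ch : Chain x y) → Backward ch → n ≤ depth →
        Unique (firstEdges n ch) → Distinct (firstEdges n ch)
      backward-distinct zero ch bw le u = []
      backward-distinct (suc n) [] bw le u = []
      backward-distinct {x = x} (suc n) ((q , _) ∷ ch) (q∈ , bw) le u
        with uq , uc , dis ← unique-++⁻ (rights (items q)) u = AllPairs.++⁺
        (near-distinct x uq (λ f∈ → arc (rev q) , q∈ , refl , rev-edges q f∈))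
        (backward-distinct n ch bw (≤-trans (n≤1+n n) le) uc)
        (All.tabulate λ f∈ → All.tabulate λ g∈ → good q∈ (rev-edges q f∈)
          (reach-mono x le (reach-step n q∈ (backward-reach n ch bw g∈))) λ { refl → dis f∈ g∈ })

      -- Formulated for a list of items, not for a chain, so that it survives rotating the chain and
      -- replacing two links by their concatenation.
      record Rainbow (T : List Item) : Set where
        constructor rainbow
        field
          chosen   : List E
          chosen-∈ : ∀ {f} → f ∈ chosen → inj₂ f ∈ T
          distinct : Distinct chosen
          enough   : length (rights T) ⊓ depth ≤ length chosen

      rotate-rainbow : ∀ xs ys → Rainbow (ys ++ xs) → Rainbow (xs ++ ys)
      rotate-rainbow xs ys (rainbow fs ∈fs d n) = rainbow fs
        (λ f∈ → Sum.[ ∈-++⁺ʳ xs , ∈-++⁺ˡ ]′ (∈-++⁻ ys (∈fs f∈))) d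
        (≤-trans (≤-reflexive (cong (_⊓ depth) (trans (len xs ys)
            (trans (+-comm _ (length (rights ys))) (sym (len ys xs)))))) n)
        where
        len : ∀ xs ys → length (rights (xs ++ ys)) ≡ length (rights xs) + length (rights ys)
        len xs ys = trans (cong length (rights-++ xs ys)) (length-++ (rights xs))

      directed : (ch : Chain x y) →
        (∀ n → n ≤ depth → Unique (firstEdges n ch) → Distinct (firstEdges n ch)) →
        Unique (total ch) → Rainbow (total ch)
      directed ch h u with fs , eq ← firstEdges-prefix depth ch = rainbow (firstEdges depth ch)
        (λ f∈ → ∈-rights⁻ (subst (_ ∈_) (sym eq) (∈-++⁺ˡ f∈)))
        (h depth ≤-refl (proj₁ (unique-++⁻ (firstEdges depth ch)
            (subst Unique eq (rights-unique u)))))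
        (length-firstEdges depth ch)

      data Scan {x z : V} (ch : Chain x z) : Set where
        forward : Forward ch → Scan ch
        turn    : ∀ {y m w} (before : Chain x y) (q : Walk y m) (q∈ : arc q ∈ arcs)
                  (r : Walk m w) (r∈ : arc (rev r) ∈ arcs) (after : Chain w z) →
                  total ch ≡ total before ++ total ((q , inj₁ q∈) ∷ (r , inj₂ r∈) ∷ after) →
                  links ch ≡ links before + (2 + links after) → Scan ch

      -- With a forward link at the start, the first backward link directly follows a forward one,
      -- and both point to the vertex between them.
      scan : (q : Walk x y) (q∈ : arc q ∈ arcs) (ch : Chain y z) → Scan ((q , inj₁ q∈) ∷ ch)
      scan q q∈ [] = forward (q∈ , tt)
      scan q q∈ ((r , inj₂ r∈) ∷ ch) = turn [] q q∈ r r∈ ch refl refl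
      scan q q∈ ((r , inj₁ r∈) ∷ ch) with scan r r∈ ch
      ... | forward fw = forward (q∈ , fw)
      ... | turn before q′ q′∈ r′ r′∈ after eq eq′ =
        turn ((q , inj₁ q∈) ∷ before) q′ q′∈ r′ r′∈ after (trans (cong (λ is → items q ++ inj₁ _ ∷ is) eq)
            (sym (++-assoc (items q) (inj₁ _ ∷ total before) _))) (cong suc eq′)

      data Seek {x z : V} (ch : Chain x z) : Set where
        backward : Backward ch → Seek ch
        meet     : ∀ {y w} (before : Chain x y) (q : Walk y w) (q∈ : arc q ∈ arcs)
                   (after : Chain w z) →
                   total ch ≡ total before ++ total ((q , inj₁ q∈) ∷ after) →
                   links ch ≡ links before + suc (links after) → Seek ch

      seek : (ch : Chain x y) → Seek ch
      seek [] = backward tt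
      seek ((q , inj₁ q∈) ∷ ch) = meet [] q q∈ ch refl refl
      seek ((q , inj₂ q∈) ∷ ch) with seek ch
      ... | backward bw = backward (q∈ , bw)
      ... | meet before r r∈ after eq eq′ = meet ((q , inj₂ q∈) ∷ before) r r∈ after
        (trans (cong (λ is → items q ++ inj₁ _ ∷ is) eq)
            (sym (++-assoc (items q) (inj₁ _ ∷ total before) _))) (cong suc eq′)

      merged-distinct : ∀ {m} (q : Walk x m) → arc q ∈ arcs → (r : Walk m y) → arc (rev r) ∈ arcs →
                        Unique (items (q ∙ r)) → Distinct (rights (items (q ∙ r)))
      merged-distinct {m = m} q q∈ r r∈ u = near-distinct m (rights-unique u) λ f∈ →
        at (∈-++⁻ (items q) (subst (_ ∈_) (items-∙ q r) (∈-rights⁻ {xs = items (q ∙ r)} f∈)))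
        where
        at : ∀ {f} → inj₂ f ∈ items q ⊎ inj₂ f ∈ inj₁ m ∷ items r →
            ∃[ a ] a ∈ arcs × tgt a ≡ m × f ∈ arcEdges a
        at (inj₁ f∈) = arc q , q∈ , refl , ∈-rights⁺ f∈
        at (inj₂ (there f∈)) = arc (rev r) , r∈ , refl , rev-edges r (∈-rights⁺ f∈)

      mutual
        -- `n` bounds the number of links and decreases only when `turn-start` replaces two links by
        -- one. A closed chain may be rotated, first to a forward link and then to a turn. If there
        -- is no forward link, or no turn after a forward start, all links have the same direction.
        chain-rainbow : ∀ n (ch : Chain x x) → links ch ≤ n → Unique (total ch) → Rainbow (total ch)
        chain-rainbow n [] le u = rainbow [] (λ ()) [] z≤n
        chain-rainbow (suc n) ch@(_ ∷ _) le u with seek ch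
        ... | backward bw = directed ch (λ m → backward-distinct m ch bw) u
        ... | meet before q q∈ after eq eq′ = subst Rainbow (sym eq)
          (rotate-rainbow (total before) (total ((q , inj₁ q∈) ∷ after)) (subst Rainbow tot≡
            (forward-start n q q∈ (after ⧺ before) (≤-trans (≤-reflexive links≡) le)
              (subst Unique (sym tot≡) (unique-++-comm (total before) (subst Unique eq u))))))
          where
          tot≡ = total-⧺ ((q , inj₁ q∈) ∷ after) before
          links≡ = trans (links-⧺ ((q , inj₁ q∈) ∷ after) before)
              (trans (+-comm (suc (links after)) (links before)) (sym eq′))

        forward-start : ∀ n (q : Walk x y) (q∈ : arc q ∈ arcs) (ch : Chain y x) →
          suc (links ch) ≤ suc n → Unique (total ((q , inj₁ q∈) ∷ ch)) →
          Rainbow (total ((q , inj₁ q∈) ∷ ch))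
        forward-start n q q∈ ch le u with scan q q∈ ch
        ... | forward fw = directed ((q , inj₁ q∈) ∷ ch)
            (λ m → forward-distinct m ((q , inj₁ q∈) ∷ ch) fw) u
        ... | turn before q′ q′∈ r r∈ after eq eq′ = subst Rainbow (sym eq)
          (rotate-rainbow (total before) (total ((q′ , inj₁ q′∈) ∷ (r , inj₂ r∈) ∷ after))
              (subst Rainbow tot≡
            (turn-start n q′ q′∈ r r∈ (after ⧺ before) (≤-trans (≤-reflexive links≡) le)
              (subst Unique (sym tot≡) (unique-++-comm (total before) (subst Unique eq u))))))
          where
          tot≡ = total-⧺ ((q′ , inj₁ q′∈) ∷ (r , inj₂ r∈) ∷ after) before
          links≡ = trans (links-⧺ ((q′ , inj₁ q′∈) ∷ (r , inj₂ r∈) ∷ after) before)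
              (trans (+-comm (2 + links after) (links before)) (sym eq′))

        turn-start : ∀ n {m} (q : Walk x m) (q∈ : arc q ∈ arcs)
          (r : Walk m y) (r∈ : arc (rev r) ∈ arcs) (ch : Chain y x) →
          2 + links ch ≤ suc n → Unique (total ((q , inj₁ q∈) ∷ (r , inj₂ r∈) ∷ ch)) →
          Rainbow (total ((q , inj₁ q∈) ∷ (r , inj₂ r∈) ∷ ch))
        turn-start {x} {y} n {m} q q∈ r r∈ ch le u = subst Rainbow (sym eq)
            (cases (inner q + suc (inner r) ≤? t) (x ≟ᵥ y))
          where
          T = items (q ∙ r) ++ inj₁ y ∷ total ch
          eq : total ((q , inj₁ q∈) ∷ (r , inj₂ r∈) ∷ ch) ≡ T
          eq = trans (sym (++-assoc (items q) (inj₁ m ∷ items r) (inj₁ y ∷ total ch)))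
              (cong (_++ inj₁ y ∷ total ch) (sym (items-∙ q r)))
          T! = subst Unique eq u
          qr! = proj₁ (unique-++⁻ (items (q ∙ r)) T!)
          all-edges : length (rights T) ⊓ depth ≤ length (rights (items (q ∙ r))) → Rainbow T
          all-edges = rainbow (rights (items (q ∙ r)))
              (λ f∈ → ∈-++⁺ˡ (∈-rights⁻ {xs = items (q ∙ r)} f∈)) (merged-distinct q q∈ r r∈ qr!)
          -- A nonempty rest would end at `x`, which equals `y` and is already listed as the end of
          -- `q ∙ r`. So the rest is empty, and `q ∙ r` contains all the edges.
          closed : (ch : Chain y x) → x ≡ y → Unique (items (q ∙ r) ++ inj₁ y ∷ total ch) →
            length (rights (items (q ∙ r) ++ inj₁ y ∷ total ch)) ⊓ depth
              ≤ length (rights (items (q ∙ r)))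
          closed [] _ _ = ≤-trans (m⊓n≤m _ depth) (≤-reflexive
              (trans (cong length (rights-++ (items (q ∙ r)) (inj₁ y ∷ [])))
            (trans (length-++ (rights (items (q ∙ r)))) (+-identityʳ _))))
          closed ch@(_ ∷ _) x≡y u′ with p ∷ _ ← proj₁ (proj₂ (unique-++⁻ (items (q ∙ r)) u′)) =
            contradiction (cong inj₁ (sym x≡y)) (All.lookup p (end-∈ ch (s≤s z≤n)))
          cases : Dec (inner q + suc (inner r) ≤ t) → Dec (x ≡ y) → Rainbow T
          -- More than `t` inner vertices mean at least `t + 2 = depth` edges, all of them on arcs
          -- into `m`.
          cases (no big) _ = all-edges (≤-trans (m⊓n≤n _ depth) (≤-trans (s≤s (≰⇒> big))
            (≤-reflexive (sym (trans (length-rights-items (q ∙ r)) (cong suc (inner-∙ q r)))))))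
          cases (yes small) (yes x≡y) = all-edges (closed ch x≡y T!)
          cases (yes small) (no x≢y) = chain-rainbow n ((q ∙ r , link) ∷ ch) (s≤s⁻¹ le) T!
            where
            link : arc (q ∙ r) ∈± arcs
            -- The two arcs into `m` are `q` and `rev r`, so `merge` delivers `q ∙ rev (rev r)`.
            link = subst (λ r′ → arc (q ∙ r′) ∈± arcs) (rev-rev r) (merge q∈ r∈
              (≤-trans (≤-reflexive (cong (λ i → inner q + suc i) (inner-rev r))) small) x≢y
              (subst (λ r′ → Unique (items (q ∙ r′))) (sym (rev-rev r)) qr!))

      toChain : Walk x y → Chain x y
      toChain (edge e j) = (edge e j , edges e j) ∷ []
      toChain (step e j q) = (edge e j , edges e j) ∷ toChain q

      total-toChain : (q : Walk x y) → total (toChain q) ≡ items q ++ inj₁ y ∷ []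
      total-toChain (edge e j) = refl
      total-toChain (step e j q) = cong (λ is → inj₂ e ∷ inj₁ _ ∷ is) (total-toChain q)

      closed-walk-rainbow : (q : Walk x x) → Unique (items q ++ inj₁ x ∷ []) →
        Rainbow (items q ++ inj₁ x ∷ [])
      closed-walk-rainbow q u = subst Rainbow (total-toChain q)
        (chain-rainbow (links (toChain q)) (toChain q) ≤-refl
            (subst Unique (sym (total-toChain q)) u))

      arb-colouring : ArbColouring (suc t) G c
      arb-colouring record { excess = n ; copy = φ } = at (closed-walk-rainbow q
          (subst Unique items≡ (Unique.map⁺ (mapItem-injective φ) base!)))
        where
        module W = Walks (cycleGraph n)
        incident : ∀ i → (i , snoc suc zero i) ≡ (cons zero suc i , snoc suc zero i)
        incident zero = refl
        incident (suc i) = refl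
        base : W.Walk zero zero
        base = W.segment suc (λ i → i) incident
        base! : Unique (W.items base ++ inj₁ zero ∷ [])
        base! = Unique.++⁺ (W.segment-unique suc (λ i → i) incident Fin.suc-injective (λ eq → eq))
            ([] ∷ [])
          λ { (y∈ , here refl) → Sum.[ (λ ()) , (λ ()) ]′
              (W.segment-items suc (λ i → i) incident y∈) }
        q : Walk (onV φ zero) (onV φ zero)
        q = mapWalk φ base
        T = items q ++ inj₁ (onV φ zero) ∷ []
        items≡ : map (mapItem φ) (W.items base ++ inj₁ zero ∷ []) ≡ T
        items≡ = trans (map-++ (mapItem φ) (W.items base) (inj₁ zero ∷ []))
            (cong (_++ inj₁ (onV φ zero) ∷ []) (sym (items-mapWalk φ base)))
        length≡ : length (rights T) ≡ 2 + n
        length≡ = trans (cong length (rights-++ (items q) (inj₁ (onV φ zero) ∷ [])))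
            (trans (length-++ (rights (items q)))
          (trans (+-identityʳ _) (trans (length-rights-items q)
              (cong suc (trans (inner-mapWalk φ base) (W.segment-inner suc (λ i → i) incident))))))
        cover : ∀ {f} → inj₂ f ∈ T → ∃[ i ] onE φ i ≡ f
        cover {f} f∈ with ∈-map⁻ (mapItem φ) {xs = W.items base ++ inj₁ zero ∷ []}
            (subst (inj₂ f ∈_) (sym items≡) f∈)
        ... | inj₂ i , _ , refl = i , refl
        at : Rainbow T → (2 + n) ⊓ (suc t + 1) ≤ countDistinct (c ∘ onE φ)
        at (rainbow fs fs∈ d n≤) = ≤-trans (≤-reflexive
            (cong₂ _⊓_ (sym length≡) (+-comm (suc t) 1)))
          (≤-trans n≤ (≤countDistinct (onE φ) c fs (λ f∈ → cover (fs∈ f∈)) (AllPairs.map⁺ d)))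

  -- Polynomial bounds

  -- The bounds of `Initial.initial` and `Step.next`. The number of rounds does not depend on `k`,
  -- so for fixed `t` and `i` both are polynomial in `k`.
  inBound throughBoundAt : (t k i : ℕ) → ℕ
  inBound t k zero = 2 * densityBound t k 1
  inBound t k (suc i) =
    2 * densityBound t k (throughBound (inBound t k i) (throughBoundAt t k i)) + inBound t k i
  throughBoundAt t k zero = 1
  throughBoundAt t k (suc i) =
    throughBound (inBound t k i) (throughBoundAt t k i) + throughBoundAt t k i

  colourBound : (t k : ℕ) → ℕ
  colourBound t k = suc (2 * (throughBoundAt t k t * reachBound t (inBound t k t) (2 + t)))

  module _ (G : Multigraph) {t k : ℕ} (sparse : Arcs.Sparse G t k) where
    open Augment G sparse

    stage : ∀ i → i ≤ t → Stage i (inBound t k i) (throughBoundAt t k i)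
    stage zero _ = Initial.initial
    stage (suc i) i<t = Step.next i<t (stage i (≤-trans (n≤1+n i) i<t))

    arb-colourable : ArbColourable (suc t) G (colourBound t k)
    arb-colourable = let c , good = Anc.good-colouring in c , Anc.Rainbows.arb-colouring c good
      where module Anc = Ancestors G sparse (stage t ≤-refl)

  -- Only positive arguments are constrained: there a power grows with its exponent, so that for
  -- sums as well as for products the exponents can be added.
  record PolyBounded (f : ℕ → ℕ) : Set where
    constructor by
    field
      factor exponent : ℕ
      bounded         : ∀ k → f (suc k) ≤ factor * suc k ^ exponent

  poly-const : ∀ c → PolyBounded (λ _ → c)
  poly-const c = by c 0 λ k → ≤-reflexive (sym (*-identityʳ c))

  poly-id : PolyBounded (λ k → k)
  poly-id = by 1 1 λ k → ≤-reflexive (sym (trans (*-identityˡ _) (^-identityʳ (suc k))))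

  poly-+ : ∀ {f g} → PolyBounded f → PolyBounded g → PolyBounded (λ k → f k + g k)
  poly-+ (by c e f≤) (by c′ e′ g≤) = by (c + c′) (e + e′) λ k → ≤-trans
    (+-mono-≤ (≤-trans (f≤ k) (*-monoʳ-≤ c (^-monoʳ-≤ (suc k) (m≤m+n e e′))))
              (≤-trans (g≤ k) (*-monoʳ-≤ c′ (^-monoʳ-≤ (suc k) (m≤n+m e′ e)))))
    (≤-reflexive (sym (*-distribʳ-+ (suc k ^ (e + e′)) c c′)))

  poly-* : ∀ {f g} → PolyBounded f → PolyBounded g → PolyBounded (λ k → f k * g k)
  poly-* (by c e f≤) (by c′ e′ g≤) = by (c * c′) (e + e′) λ k → ≤-trans (*-mono-≤ (f≤ k) (g≤ k))
    (≤-reflexive (trans ([m*n]*[o*p]≡[m*o]*[n*p] c (suc k ^ e) c′ (suc k ^ e′))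
      (cong (c * c′ *_) (sym (^-distribˡ-+-* (suc k) e e′)))))

  poly-densityBound : ∀ t {f} → PolyBounded f → PolyBounded (λ k → densityBound t k (f k))
  poly-densityBound t f = poly-+ f (poly-* poly-id (poly-* (poly-const (suc (t + t))) f))

  poly-throughBound : ∀ {f g} → PolyBounded f → PolyBounded g →
      PolyBounded (λ k → throughBound (f k) (g k))
  poly-throughBound f g = poly-+ (poly-* f (poly-+ g f)) (poly-* f g)

  poly-inBound : ∀ t i → PolyBounded (λ k → inBound t k i)
  poly-throughBoundAt : ∀ t i → PolyBounded (λ k → throughBoundAt t k i)
  poly-inBound t zero = poly-* {f = λ _ → 2} (poly-const 2) (poly-densityBound t (poly-const 1))
  poly-inBound t (suc i) = poly-+ (poly-* {f = λ _ → 2} (poly-const 2) (poly-densityBound t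
    (poly-throughBound (poly-inBound t i) (poly-throughBoundAt t i)))) (poly-inBound t i)
  poly-throughBoundAt t zero = poly-const 1
  poly-throughBoundAt t (suc i) = poly-+ (poly-throughBound (poly-inBound t i)
      (poly-throughBoundAt t i)) (poly-throughBoundAt t i)

  poly-reachBound : ∀ t {f} → PolyBounded f → ∀ n → PolyBounded (λ k → reachBound t (f k) n)
  poly-reachBound t f zero = poly-* f (poly-const (suc t))
  poly-reachBound t f (suc n) = poly-+ (poly-* f (poly-const (suc t)))
      (poly-* f (poly-reachBound t f n))

  poly-colourBound : ∀ t → PolyBounded (colourBound t)
  poly-colourBound t = poly-+ {f = λ _ → 1} (poly-const 1) (poly-* {f = λ _ → 2} (poly-const 2)
    (poly-* (poly-throughBoundAt t t) (poly-reachBound t (poly-inBound t t) (2 + t))))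

  -- Rational estimates and evaluation of polynomials

  ι : ℕ → ℚ
  ι n = ℤ.+ n ℚ./ 1

  -- A normalised fraction has been divided by a gcd, so cross-multiplication is carried out on the
  -- unnormalised representatives.
  /≤/⁺ : ∀ a b c d → a * suc d ≤ c * suc b → ℤ.+ a ℚ./ suc b ℚ.≤ ℤ.+ c ℚ./ suc d
  /≤/⁺ a b c d le = ℚ.toℚᵘ-cancel-≤ (ℚᵘ.≤-respˡ-≃ (ℚᵘ.≃-sym (ℚ.toℚᵘ-fromℚᵘ (ℚᵘ.mkℚᵘ (ℤ.+ a) b)))
    (ℚᵘ.≤-respʳ-≃ (ℚᵘ.≃-sym (ℚ.toℚᵘ-fromℚᵘ (ℚᵘ.mkℚᵘ (ℤ.+ c) d)))
      (ℚᵘ.*≤* (subst₂ ℤ._≤_ (ℤ.pos-* a (suc d)) (ℤ.pos-* c (suc b)) (ℤ.+≤+ le)))))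

  /≤/⁻ : ∀ a b c d → ℤ.+ a ℚ./ suc b ℚ.≤ ℤ.+ c ℚ./ suc d → a * suc d ≤ c * suc b
  /≤/⁻ a b c d le = ℤ.drop‿+≤+ (subst₂ ℤ._≤_ (sym (ℤ.pos-* a (suc d))) (sym (ℤ.pos-* c (suc b)))
    (ℚᵘ.drop-*≤* (ℚᵘ.≤-respˡ-≃ (ℚ.toℚᵘ-fromℚᵘ (ℚᵘ.mkℚᵘ (ℤ.+ a) b))
        (ℚᵘ.≤-respʳ-≃ (ℚ.toℚᵘ-fromℚᵘ (ℚᵘ.mkℚᵘ (ℤ.+ c) d)) (ℚ.toℚᵘ-mono-≤ le)))))

  ι-mono : ∀ {m n} → m ≤ n → ι m ℚ.≤ ι n
  ι-mono {m} {n} le = /≤/⁺ m 0 n 0 (*-monoˡ-≤ 1 le)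

  ι-* : ∀ m n → ι (m * n) ≡ ι m ℚ.* ι n
  ι-* m n = ℚ.toℚᵘ-injective (ℚᵘ.≃-trans (ℚ.toℚᵘ-fromℚᵘ (ℚᵘ.mkℚᵘ (ℤ.+ (m * n)) 0))
    (ℚᵘ.≃-trans (ℚᵘ.*≡* (cong (ℤ._* ℤ.+ 1) (ℤ.pos-* m n)))
      (ℚᵘ.≃-sym (ℚᵘ.≃-trans (ℚ.toℚᵘ-homo-* (ι m) (ι n))
        (ℚᵘ.*-cong (ℚ.toℚᵘ-fromℚᵘ (ℚᵘ.mkℚᵘ (ℤ.+ m) 0)) (ℚ.toℚᵘ-fromℚᵘ (ℚᵘ.mkℚᵘ (ℤ.+ n) 0)))))))

  1+/≡ : ∀ m n → 1ℚ ℚ.+ ℤ.+ m ℚ./ suc n ≡ ℤ.+ (suc n + m) ℚ./ suc n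
  1+/≡ m n = ℚ.toℚᵘ-injective (ℚᵘ.≃-trans (ℚ.toℚᵘ-homo-+ 1ℚ (ℤ.+ m ℚ./ suc n))
    (ℚᵘ.≃-trans (ℚᵘ.+-congʳ ℚᵘ.1ℚᵘ (ℚ.toℚᵘ-fromℚᵘ (ℚᵘ.mkℚᵘ (ℤ.+ m) n)))
      (ℚᵘ.≃-trans (ℚᵘ.*≡* (cong₂ ℤ._*_ (cong₂ ℤ._+_ (ℤ.*-identityˡ (ℤ.+ suc n))
          (ℤ.*-identityʳ (ℤ.+ m))) (cong (λ d → ℤ.+ suc d) (sym (+-identityʳ n)))))
          (ℚᵘ.≃-sym (ℚ.toℚᵘ-fromℚᵘ (ℚᵘ.mkℚᵘ (ℤ.+ (suc n + m)) n))))))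

  -- The coefficients of a + (1 + x) P(x).
  timesOnePlus : ℚ → Polynomial → Polynomial
  timesOnePlus a [] = a ∷ []
  timesOnePlus a (b ∷ P) = (a ℚ.+ b) ∷ timesOnePlus b P

  eval-timesOnePlus : ∀ a P x → eval (timesOnePlus a P) x ≡ a ℚ.+ (1ℚ ℚ.+ x) ℚ.* eval P x
  eval-timesOnePlus a [] x = solve 2 (λ a x → a :+ x :* con 0ℚ := a :+ (con 1ℚ :+ x) :* con 0ℚ)
      refl a x
    where open +-*-Solver
  eval-timesOnePlus a (b ∷ P) x = trans (cong (λ y → (a ℚ.+ b) ℚ.+ x ℚ.* y)
      (eval-timesOnePlus b P x))
    (solve 4 (λ a b x y → (a :+ b) :+ x :* (b :+ (con 1ℚ :+ x) :* y) := a :+ (con 1ℚ :+ x) :*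
        (b :+ x :* y)) refl a b x (eval P x))
    where open +-*-Solver

  -- The expanded form of c(1 + x)^e.
  powerPoly : (c e : ℕ) → Polynomial
  powerPoly c zero = ι c ∷ []
  powerPoly c (suc e) = timesOnePlus 0ℚ (powerPoly c e)

  power≤eval : ∀ c e k {x} → ι k ℚ.≤ 1ℚ ℚ.+ x → ι (c * k ^ e) ℚ.≤ eval (powerPoly c e) x
  power≤eval c zero k {x} le = ℚ.≤-reflexive (trans (cong ι (*-identityʳ c))
    (solve 2 (λ c x → c := c :+ x :* con 0ℚ) refl (ι c) x))
    where open +-*-Solver
  power≤eval c (suc e) k {x} le = begin
    ι (c * (k * k ^ e)) ≡⟨ cong ι (trans (sym (*-assoc c k (k ^ e)))
        (trans (cong (_* k ^ e) (*-comm c k)) (*-assoc k c (k ^ e)))) ⟩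
    ι (k * (c * k ^ e)) ≡⟨ ι-* k (c * k ^ e) ⟩
    ι k ℚ.* ι (c * k ^ e) ≤⟨ ℚ.*-monoʳ-≤-nonNeg (ι (c * k ^ e))
        {{ℚ.normalize-nonNeg (c * k ^ e) 1}} le ⟩
    -- That `1 + x` is nonnegative follows from `ι k ≤ 1 + x`; no assumption on the sign of `x` is
    -- made.
    (1ℚ ℚ.+ x) ℚ.* ι (c * k ^ e) ≤⟨ ℚ.*-monoˡ-≤-nonNeg (1ℚ ℚ.+ x)
        {{ℚ.nonNegative (ℚ.≤-trans (ι-mono {0} {k} z≤n) le)}} (power≤eval c e k {x} le) ⟩
    (1ℚ ℚ.+ x) ℚ.* eval (powerPoly c e) x ≡⟨ sym (ℚ.+-identityˡ _) ⟩
    0ℚ ℚ.+ (1ℚ ℚ.+ x) ℚ.* eval (powerPoly c e) x ≡⟨ sym (eval-timesOnePlus 0ℚ (powerPoly c e) x) ⟩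
    eval (powerPoly c (suc e)) x ∎
    where open ℚ.≤-Reasoning

  ratio≤ : ∀ n m k → m ≤ n * k → ratio n m ℚ.≤ ι k
  ratio≤ zero m k le = ι-mono {0} {k} z≤n
  ratio≤ (suc n) m k le = /≤/⁺ m n k 0 (≤-trans (≤-reflexive (*-identityʳ m))
      (≤-trans le (≤-reflexive (*-comm (suc n) k))))

  -- For order 0 the value of `ratio` says nothing about the number of edges, so the bound on
  -- `size H` has to come from the ends of an edge.
  edgeless : ∀ H → order H ≡ 0 → size H ≡ 0
  edgeless record { order = zero ; size = zero } refl = refl
  edgeless record { order = zero ; size = suc _ ; ends = ends } refl with () ← proj₁ (ends zero)

  ≤ratio : ∀ H k → density H ℚ.≤ ι k → size H ≤ order H * k
  ≤ratio H k le with order H in eq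
  ... | zero = ≤-reflexive (edgeless H eq)
  ... | suc n = ≤-trans (≤-reflexive (sym (*-identityʳ (size H))))
      (≤-trans (/≤/⁻ (size H) n k 0 le) (≤-reflexive (*-comm k (suc n))))

  -- The floor plus one is taken, not the ceiling, which makes the integer positive as `PolyBounded`
  -- requires.
  ratio-ceiling : ∀ n m → ∃[ k ] ratio n m ℚ.≤ ι (suc k) × ι (suc k) ℚ.≤ 1ℚ ℚ.+ ratio n m
  ratio-ceiling zero m = 0 , ι-mono {0} {1} z≤n , ℚ.≤-refl
  ratio-ceiling (suc n) m = k , ratio≤ (suc n) m (suc k) upper , ℚ.≤-trans
      (/≤/⁺ (suc k) 0 (suc n + m) n (≤-trans (+-monoʳ-≤ (suc n) (m/n*n≤m m (suc n)))
          (≤-reflexive (sym (*-identityʳ (suc n + m))))))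
      (ℚ.≤-reflexive (sym (1+/≡ m n)))
    where
    k = m ℕ./ suc n
    upper : m ≤ suc n * suc k
    upper = ≤-trans (≤-reflexive (m≡m%n+[m/n]*n m (suc n)))
        (≤-trans (+-monoˡ-≤ (k * suc n) (<⇒≤ (m%n<n m (suc n))))
      (≤-reflexive (*-comm (suc k) (suc n))))

  -- Lower bound

  module ClosedWalk (G : Multigraph) where
    open Walks (graph G)

    joins-≢ : ∀ {e u v} → Joins e u v → u ≢ v
    joins-≢ {e = e} (inj₁ refl) = Multigraph.loopless G e
    joins-≢ {e = e} (inj₂ refl) = Multigraph.loopless G e ∘ sym

    closed-inner : ∀ {x} (q : Walk x x) → 1 ≤ inner q
    closed-inner (edge e j) = contradiction refl (joins-≢ j)
    closed-inner (step e j q) = s≤s z≤n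

    -- The `n + 2` vertices of the cycle are `x` and the `n + 1` inner ones. As `closed-inner`
    -- excludes a single edge, every closed walk without repetition is such a copy, 2-cycles
    -- included.
    cycleCopy : ∀ {n x} (q : Walk x x) → inner q ≡ suc n → Unique (inj₁ x ∷ items q) →
      Σ[ φ ∈ cycleGraph n ↪ graph G ] (∀ i → inj₂ (onE φ i) ∈ items q) ×
          (∀ {e} → inj₂ e ∈ items q → ∃[ i ] onE φ i ≡ e)
    cycleCopy {x = x} q@(step _ _ _) refl (x∉ ∷ u) = record
      { onV = cons x (vertexAt q) ; onE = edgeAt q
      ; injectV = λ {i} {j} → inject i j
      ; injectE = edgeAt-injective q u
      ; incidence = λ i → subst (Joins (edgeAt q i) (cons x (vertexAt q) i))
          (sym (snoc-map (cons x (vertexAt q)) refl (λ _ → refl) i)) (edgeAt-joins q i)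
      } , edgeAt-∈ q , ∈-edgeAt q
      where
      inject : ∀ i j → cons x (vertexAt q) i ≡ cons x (vertexAt q) j → i ≡ j
      inject zero zero eq = refl
      inject zero (suc j) eq = contradiction (cong inj₁ eq) (All.lookup x∉ (vertexAt-∈ q j))
      inject (suc i) zero eq = contradiction (cong inj₁ (sym eq)) (All.lookup x∉ (vertexAt-∈ q i))
      inject (suc i) (suc j) eq = cong suc (vertexAt-injective q u eq)

  -- Position `i` can be left out, because its value also occurs at `j`.
  repeated⇒countDistinct< : ∀ {n k} (f : Fin (suc n) → Fin k) {i j} → i ≢ j → f i ≡ f j →
      countDistinct f ≤ n
  repeated⇒countDistinct< f {i} {j} i≢j eq = countDistinct≤ f (f ∘ punchIn i) cover
    where
    cover : ∀ l → ∃[ m ] f l ≡ f (punchIn i m)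
    cover l with i Fin.≟ l
    ... | yes refl = punchOut i≢j , trans eq (cong f (sym (Fin.punchIn-punchOut i≢j)))
    ... | no i≢l = punchOut i≢l , cong f (sym (Fin.punchIn-punchOut i≢l))

  module _ (G : Multigraph) {p k : ℕ} {c : Fin (size G) → Fin k} (arb : ArbColouring p G c) where
    open Walks (graph G)
    open ClosedWalk G

    -- If the required minimum is the length of the cycle, a repeated colour violates it; if it is
    -- `p + 1`, the palette of `p` colours does.
    no-poor-closed-walk : ∀ {x} (q : Walk x x) → Unique (inj₁ x ∷ items q) →
      (palette : Fin p → Fin k) → (∀ {e} → inj₂ e ∈ items q → ∃[ j ] c e ≡ palette j) →
      ∀ {e f} → inj₂ e ∈ items q → inj₂ f ∈ items q → e ≢ f → c e ≢ c f
    no-poor-closed-walk q u palette few e∈ f∈ e≢f eq with inner q in n≡ | closed-inner q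
    ... | suc n | _ with φ , φ∈ , cover ← cycleCopy q n≡ u with i , refl ← cover e∈ | j , refl ←
        cover f∈
      with ⊓-sel (2 + n) (p + 1)
    ... | inj₁ m = contradiction (≤-trans (≤-reflexive (sym m)) (≤-trans (arb record { copy = φ })
          (repeated⇒countDistinct< (c ∘ onE φ) (e≢f ∘ cong (onE φ)) eq))) 1+n≰n
    ... | inj₂ m = contradiction (≤-trans (≤-reflexive (trans (+-comm 1 p) (sym m)))
        (≤-trans (arb record { copy = φ })
          (countDistinct≤ (c ∘ onE φ) palette (λ i → few (φ∈ i))))) 1+n≰n

  -- Expanding walks of a multigraph in its subdivision

  module Subdivision (H : Multigraph) (s : Fin (size H) → ℕ) where
    private
      S = subdivide H s
      module H = Walks (graph H)
      module S = Walks S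

    -- Items with different origins are different. This reduces the absence of repetition in an
    -- expanded walk to that in the walk and to that within a single path.
    origin : Graph.V S ⊎ Graph.E S → Fin (order H) ⊎ Fin (size H)
    origin (inj₁ (inj₁ x)) = inj₁ x
    origin (inj₁ (inj₂ (e , _))) = inj₂ e
    origin (inj₂ (e , _)) = inj₂ e

    private
      new : ∀ e → Fin (s e) → Graph.V S
      new e j = inj₂ (e , j)

    path : ∀ e → S.Walk (inj₁ (proj₁ (Multigraph.ends H e))) (inj₁ (proj₂ (Multigraph.ends H e)))
    path e = S.segment (new e) (e ,_) (λ i → refl)

    path-origin : ∀ e {y} → y ∈ S.items (path e) → origin y ≡ inj₂ e
    path-origin e y∈ with S.segment-items (new e) (e ,_) (λ i → refl) y∈
    ... | inj₁ (_ , refl) = refl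
    ... | inj₂ (_ , refl) = refl

    path! : ∀ e → Unique (S.items (path e))
    path! e = S.segment-unique (new e) (e ,_) (λ i → refl) (λ { refl → refl }) (λ { refl → refl })

    expandEdge : ∀ {u v} e → H.Joins e u v → S.Walk (inj₁ u) (inj₁ v)
    expandEdge e (inj₁ refl) = path e
    expandEdge e (inj₂ refl) = S.rev (path e)

    expandEdge-origin : ∀ {u v} e (j : H.Joins e u v) {y} → y ∈ S.items (expandEdge e j) →
        origin y ≡ inj₂ e
    expandEdge-origin e (inj₁ refl) y∈ = path-origin e y∈
    expandEdge-origin e (inj₂ refl) y∈ = path-origin e
        (reverse⁻ (subst (_ ∈_) (S.items-rev (path e)) y∈))

    expandEdge! : ∀ {u v} e (j : H.Joins e u v) → Unique (S.items (expandEdge e j))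
    expandEdge! e (inj₁ refl) = path! e
    expandEdge! e (inj₂ refl) = subst Unique (sym (S.items-rev (path e))) (unique-reverse (path! e))

    expandEdge-first : ∀ {u v} e (j : H.Joins e u v) → inj₂ (e , zero) ∈ S.items (expandEdge e j)
    expandEdge-first e (inj₁ refl) = S.segment-edge-∈ (new e) (e ,_) (λ i → refl)
    expandEdge-first e (inj₂ refl) = subst (_ ∈_) (sym (S.items-rev (path e)))
      (reverse⁺ (S.segment-edge-∈ (new e) (e ,_) (λ i → refl)))

    expand : ∀ {u v} → H.Walk u v → S.Walk (inj₁ u) (inj₁ v)
    expand (H.edge e j) = expandEdge e j
    expand (H.step e j q) = expandEdge e j S.∙ expand q

    expand-origin : ∀ {u v} (q : H.Walk u v) {y} → y ∈ S.items (expand q) → origin y ∈ H.items q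
    expand-origin (H.edge e j) y∈ = here (expandEdge-origin e j y∈)
    expand-origin (H.step e j q) {y} y∈ with ∈-++⁻ (S.items (expandEdge e j))
        (subst (y ∈_) (S.items-∙ (expandEdge e j) (expand q)) y∈)
    ... | inj₁ y∈e = here (expandEdge-origin e j y∈e)
    ... | inj₂ (here refl) = there (here refl)
    ... | inj₂ (there y∈q) = there (there (expand-origin q y∈q))

    expand! : ∀ {u v} (q : H.Walk u v) → Unique (H.items q) → Unique (S.items (expand q))
    expand! (H.edge e j) _ = expandEdge! e j
    expand! (H.step {v = v} e j q) (e∉ ∷ v∉ ∷ u) = subst Unique
        (sym (S.items-∙ (expandEdge e j) (expand q)))
      (Unique.++⁺ (expandEdge! e j)
        (All.tabulate (λ y∈ eq → All.lookup v∉ (expand-origin q y∈) (cong origin eq)) ∷ expand! q u)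
        λ { (y∈ , here refl) → case-vertex (expandEdge-origin e j y∈)
          ; (y∈ , there y∈q) → All.lookup e∉ (there (expand-origin q y∈q))
              (sym (expandEdge-origin e j y∈)) })
      where
      case-vertex : ¬ (inj₁ v ≡ inj₂ e)
      case-vertex ()

    expand-first : ∀ {u v} (q : H.Walk u v) {e} → inj₂ e ∈ H.items q →
        inj₂ (e , zero) ∈ S.items (expand q)
    expand-first (H.edge e j) (here refl) = expandEdge-first e j
    expand-first (H.step e j q) (here refl) = subst (_ ∈_)
        (sym (S.items-∙ (expandEdge e j) (expand q))) (∈-++⁺ˡ (expandEdge-first e j))
    expand-first (H.step e j q) (there (there e∈)) = subst (_ ∈_)
        (sym (S.items-∙ (expandEdge e j) (expand q)))
      (∈-++⁺ʳ (S.items (expandEdge e j)) (there (expand-first q e∈)))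

  -- Acyclic sets of edges

  module Forest (H : Multigraph) where
    open Walks (graph H)
    open ClosedWalk H using (joins-≢)

    private
      V = Fin (order H)
      E = Fin (size H)
      variable
        u v w x : V

    Simple : Walk u v → Set
    Simple {u} {v} q = Unique (inj₁ u ∷ items q ++ inj₁ v ∷ [])

    joins-end : ∀ {e} → Joins e u v → Joins e w x → u ≡ w ⊎ u ≡ x
    joins-end (inj₁ refl) (inj₁ refl) = inj₁ refl
    joins-end (inj₁ refl) (inj₂ refl) = inj₂ refl
    joins-end (inj₂ refl) (inj₁ refl) = inj₂ refl
    joins-end (inj₂ refl) (inj₂ refl) = inj₁ refl

    end-∈ : ∀ {e} (q : Walk w x) → Joins e u v → inj₂ e ∈ items q →
        inj₁ u ∈ inj₁ w ∷ items q ++ inj₁ x ∷ []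
    end-∈ (edge e j) j′ (here refl) with joins-end j′ j
    ... | inj₁ refl = here refl
    ... | inj₂ refl = there (there (here refl))
    end-∈ (step e j q) j′ (here refl) with joins-end j′ j
    ... | inj₁ refl = here refl
    ... | inj₂ refl = there (there (here refl))
    end-∈ (step e j q) j′ (there (there e∈)) = there (there (end-∈ q j′ e∈))

    suffix : (q : Walk x v) → Simple q → inj₁ u ∈ items q →
             Σ[ q′ ∈ Walk u v ] Simple q′ × (∀ {y} → y ∈ items q′ → y ∈ items q)
    suffix (edge e j) _ (here ())
    suffix (step e j q) (_ ∷ _ ∷ u!) (there (here refl)) = q , u! , there ∘ there
    suffix (step e j q) (_ ∷ _ ∷ u!) (there (there u∈)) with q′ , s , sub ← suffix q u! u∈ =
        q′ , s , there ∘ there ∘ sub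

    -- Recursion from the far end: when a new first edge starts at a vertex that the simple path
    -- already contains, the part of the path from that vertex on replaces everything.
    erase-loops : (q : Walk u v) → u ≡ v ⊎ Σ[ q′ ∈ Walk u v ] Simple q′ ×
        (∀ {y} → y ∈ items q′ → y ∈ items q)
    erase-loops {u} {v} (edge e j) = inj₂ (edge e j ,
        ((λ ()) ∷ (λ eq → joins-≢ j (inj₁-injective eq)) ∷ []) ∷ ((λ ()) ∷ []) ∷ [] ∷ [] , λ y∈ →
        y∈)
    erase-loops {u} {v} (step {v = x} e j q) with u Fin.≟ v | erase-loops q
    ... | yes u≡v | _ = inj₁ u≡v
    ... | no u≢v | inj₁ refl = inj₂ (edge e j , ((λ ()) ∷ (λ eq → u≢v (inj₁-injective eq)) ∷ []) ∷
        ((λ ()) ∷ []) ∷ [] ∷ [] , λ { (here eq) → here eq })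
    ... | no u≢v | inj₂ (q′ , s , sub) with DecMem._∈?_ (≡-dec Fin._≟_ Fin._≟_) (inj₁ u) (items q′)
    ... | yes u∈ with q″ , s″ , sub″ ← suffix q′ s u∈ = inj₂ (q″ , s″ , there ∘ there ∘ sub ∘ sub″)
    ... | no u∉ = inj₂ (step e j q′ , ((λ ()) ∷ All.tabulate fresh) ∷
        ((λ ()) ∷ All.tabulate new-edge) ∷ s ,
                        λ { (here eq) → here eq ; (there (here eq)) →
                            there (here eq) ; (there (there y∈)) → there (there (sub y∈)) })
      where
      u∉all : inj₁ u ∉ inj₁ x ∷ items q′ ++ inj₁ v ∷ []
      u∉all (here eq) = joins-≢ j (inj₁-injective eq)
      u∉all (there u∈) with ∈-++⁻ (items q′) u∈
      ... | inj₁ u∈q = u∉ u∈q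
      ... | inj₂ (here eq) = u≢v (inj₁-injective eq)
      fresh : ∀ {y} → y ∈ inj₁ x ∷ items q′ ++ inj₁ v ∷ [] → inj₁ u ≢ y
      fresh y∈ refl = u∉all y∈
      -- If `e` were on `q′`, its end `u` would be a vertex of `q′`.
      new-edge : ∀ {y} → y ∈ items q′ ++ inj₁ v ∷ [] → inj₂ e ≢ y
      new-edge y∈ refl with ∈-++⁻ (items q′) y∈
      ... | inj₁ e∈ = u∉all (end-∈ q′ j e∈)
      ... | inj₂ (here ())

    Within : List E → Walk u v → Set
    Within es q = ∀ {e} → inj₂ e ∈ items q → e ∈ es

    Acyclic : List E → Set
    Acyclic es = ∀ {x} (q : Walk x x) → Unique (inj₁ x ∷ items q) → ¬ Within es q

    Connected : List E → V → V → Set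
    Connected es u v = u ≡ v ⊎ Σ[ q ∈ Walk u v ] Within es q

    within-∙ : ∀ {es} (q : Walk u v) (r : Walk v w) → Within es q → Within es r → Within es (q ∙ r)
    within-∙ q r a b e∈ with ∈-++⁻ (items q) (subst (_ ∈_) (items-∙ q r) e∈)
    ... | inj₁ e∈q = a e∈q
    ... | inj₂ (there e∈r) = b e∈r

    connected-trans : ∀ {es} → Connected es u v → Connected es v w → Connected es u w
    connected-trans (inj₁ refl) b = b
    connected-trans (inj₂ a) (inj₁ refl) = inj₂ a
    connected-trans (inj₂ (q , a)) (inj₂ (r , b)) = inj₂ (q ∙ r , within-∙ q r a b)

    connected-sym : ∀ {es} → Connected es u v → Connected es v u
    connected-sym (inj₁ eq) = inj₁ (sym eq)
    connected-sym (inj₂ (q , a)) = inj₂ (rev q , λ e∈ → a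
        (reverse⁻ (subst (_ ∈_) (items-rev q) e∈)))

    connected-weaken : ∀ {e es} → Connected es u v → Connected (e ∷ es) u v
    connected-weaken (inj₁ eq) = inj₁ eq
    connected-weaken (inj₂ (q , a)) = inj₂ (q , there ∘ a)

    -- Equal labels guarantee a connection, and the converse is not recorded: it suffices that an
    -- edge between equal labels would close a cycle. Then each further edge uses up one label,
    -- which gives `count`.
    record Components (es : List E) : Set where
      field
        label     : V → V
        labels    : List V
        label-∈   : ∀ v → label v ∈ labels
        connected : ∀ {u v} → label u ≡ label v → Connected es u v
        count     : length es + length labels ≤ order H

    components : ∀ es → Unique es → Acyclic es → Components es
    components [] _ _ = record
      { label = λ v → v ; labels = allFin (order H) ; label-∈ = ∈-allFin ; connected = inj₁
      ; count = ≤-reflexive (length-tabulate {n = order H} (λ v → v)) }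
    components (e ∷ es) (e∉ ∷ es!) acyclic = add (components es es!
        (λ q u a → acyclic q u (there ∘ a)))
      where
      a = proj₁ (Multigraph.ends H e)
      b = proj₂ (Multigraph.ends H e)
      link : Joins e a b
      link = inj₁ refl
      module _ (C : Components es) where
        open Components C
        -- Otherwise the earlier edges would contain a simple path from `a` to `b`, and `e`, which
        -- is not among them, would close it to a cycle.
        separate : label a ≢ label b
        separate eq with connected eq
        ... | inj₁ a≡b = Multigraph.loopless H e a≡b
        ... | inj₂ (q , within) with erase-loops q
        ... | inj₁ a≡b = Multigraph.loopless H e a≡b
        ... | inj₂ (q′ , s , sub) = acyclic (q′ ∙ edge e (inj₂ refl))
            (subst (λ is → Unique (inj₁ a ∷ is)) (trans
                (++-assoc (items q′) (inj₁ b ∷ []) (inj₂ e ∷ []))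
                (sym (items-∙ q′ (edge e (inj₂ refl)))))
              (Unique.++⁺ s ([] ∷ []) λ { (y∈ , here refl) → old y∈ }))
            (within-∙ q′ (edge e (inj₂ refl)) (there ∘ within ∘ sub) λ { (here refl) → here refl })
          where
          old : inj₂ e ∉ inj₁ a ∷ items q′ ++ inj₁ b ∷ []
          old (there e∈) with ∈-++⁻ (items q′) e∈
          ... | inj₁ e∈q = All.lookup e∉ (within (sub e∈q)) refl
          ... | inj₂ (here ())
        kept? : ∀ l → Dec (l ≢ label b)
        kept? l = ¬? (l Fin.≟ label b)
        relabel : V → V
        relabel l with l Fin.≟ label b
        ... | yes _ = label a
        ... | no _ = l
        relabel-≢ : ∀ l → relabel l ≢ label b
        relabel-≢ l eq with l Fin.≟ label b
        ... | yes _ = separate eq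
        ... | no ne = ne eq
        relabel-∈ : ∀ v → relabel (label v) ∈ labels
        relabel-∈ v with label v Fin.≟ label b
        ... | yes _ = label-∈ a
        ... | no _ = label-∈ v
        bridge : Connected (e ∷ es) a b
        bridge = inj₂ (edge e link , λ { (here refl) → here refl })
        join : ∀ {u v} → label u ≡ label a → label v ≡ label b → Connected (e ∷ es) u v
        join u~a v~b = connected-trans (connected-weaken (connected u~a))
          (connected-trans bridge (connected-weaken (connected (sym v~b))))
        connected′ : ∀ {u v} → relabel (label u) ≡ relabel (label v) → Connected (e ∷ es) u v
        connected′ {u} {v} eq with label u Fin.≟ label b | label v Fin.≟ label b
        ... | yes p | yes q = connected-weaken (connected (trans p (sym q)))
        ... | yes p | no q = connected-sym (join (sym eq) p)
        ... | no p | yes q = join eq q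
        ... | no p | no q = connected-weaken (connected eq)
        add : Components (e ∷ es)
        add = record
          { label = relabel ∘ label ; labels = filter kept? labels
          ; label-∈ = λ v → ∈-filter⁺ kept? (relabel-∈ v) (relabel-≢ (label v))
          ; connected = connected′
          ; count = ≤-trans (≤-reflexive (sym (+-suc (length es) _))) (≤-trans
              (+-monoʳ-≤ (length es) (filter-notAll kept? labels
                  (lose (label-∈ b) (λ ne → ne refl)))) count)
          }

    forest-size : ∀ es → Unique es → Acyclic es → length es ≤ order H
    forest-size es es! acyclic = ≤-trans (m≤m+n (length es) _)
        (Components.count (components es es! acyclic))

  clamp : ∀ {m} n → Fin m → Fin (suc n)
  clamp n zero = zero
  clamp zero (suc i) = zero
  clamp (suc n) (suc i) = suc (clamp n i)

  -- It ensures that the padded colour sequence misses no edge of the path, so that its entries form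
  -- a palette for the whole path.
  clamp-surjective : ∀ {m n} → n ≤ m → (i : Fin (suc n)) → ∃[ j ] clamp {suc m} n j ≡ i
  clamp-surjective le zero = zero , refl
  clamp-surjective {suc m} {suc n} (s≤s le) (suc i) with j , eq ← clamp-surjective le i =
      suc j , cong suc eq

  module LowerBound (G : Multigraph) {t k : ℕ} {c : Fin (size G) → Fin k}
      (arb : ArbColouring (suc t) G c)
                    (H : Multigraph) (s : Fin (size H) → ℕ) (s≤t : ∀ e → s e ≤ t)
                        (φ : subdivide H s ↪ graph G) where
    private
      module H = Walks (graph H)
      module S = Walks (subdivide H s)
      module G = Walks (graph G)
    open Subdivision H s
    open Forest H
    open ClosedWalk H using (joins-≢)

    -- A path with fewer than suc t edges repeats the colour of its last edge.
    colours : Fin (size H) → Fin (suc t) → Fin k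
    colours e j = c (onE φ (e , clamp (s e) j))

    code : Fin (size H) → Fin (k ^ suc t)
    code e = funToFin (colours e)

    code-class : Fin (k ^ suc t) → List (Fin (size H))
    code-class a = filter (λ e → code e Fin.≟ a) (allFin (size H))

    ∈-code-class : ∀ {a e} → e ∈ code-class a → ∀ j → colours e j ≡ finToFun a j
    ∈-code-class {a} {e} e∈ j = trans (sym (Fin.finToFun-funToFin (colours e) j))
      (cong (λ a → finToFun a j) (proj₂ (∈-filter⁻ (λ e → code e Fin.≟ a) {xs = allFin (size H)}
          e∈)))

    class-acyclic : ∀ a → Acyclic (code-class a)
    class-acyclic a {x} q u within = absurd q u within
      where
      lift : H.Walk x x → G.Walk (onV φ (inj₁ x)) (onV φ (inj₁ x))
      lift q = mapWalk φ (expand q)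
      lift! : ∀ q → Unique (inj₁ x ∷ H.items q) → Unique (inj₁ (onV φ (inj₁ x)) ∷ G.items (lift q))
      lift! q (x∉ ∷ u) = subst (λ is → Unique (inj₁ (onV φ (inj₁ x)) ∷ is))
          (sym (items-mapWalk φ (expand q)))
        (Unique.map⁺ (mapItem-injective φ) {xs = inj₁ (inj₁ x) ∷ S.items (expand q)}
          (All.tabulate (λ y∈ eq → All.lookup x∉ (expand-origin q y∈) (cong origin eq)) ∷ expand! q
              u))
      few : ∀ q → Within (code-class a) q → ∀ {f} → inj₂ f ∈ G.items (lift q) →
          ∃[ j ] c f ≡ finToFun a j
      few q within {f} f∈ with ∈-map⁻ (mapItem φ) {xs = S.items (expand q)}
          (subst (inj₂ f ∈_) (items-mapWalk φ (expand q)) f∈)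
      ... | inj₂ (e , i) , y∈ , refl with j , refl ← clamp-surjective (s≤t e) i =
        j , ∈-code-class (within (expand-origin q y∈)) j
      first-∈ : ∀ q {e} → inj₂ e ∈ H.items q → inj₂ (onE φ (e , zero)) ∈ G.items (lift q)
      first-∈ q e∈ = subst (_ ∈_) (sym (items-mapWalk φ (expand q)))
          (∈-map⁺ (mapItem φ) (expand-first q e∈))
      absurd : ∀ q → Unique (inj₁ x ∷ H.items q) → ¬ Within (code-class a) q
      absurd (H.edge e j) _ _ = joins-≢ j refl
      -- The first edge of `q′` differs from `e` and has the same code. Entry zero of the code is
      -- the colour of edge number zero on either path, in whichever direction the path is
      -- traversed, and this is the repeated colour.
      absurd q@(H.step e j q′) u@(_ ∷ (_ ∷ e∉) ∷ _) within =
          no-poor-closed-walk G arb (lift q) (lift! q u) (finToFun a) (few q within)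
        (first-∈ q e∈) (first-∈ q f∈) (λ eq → All.lookup e∉ (H.edgeAt-∈ q′ zero)
            (cong (inj₂ ∘ proj₁) (injectE φ eq)))
        (trans (∈-code-class (within e∈) zero) (sym (∈-code-class (within f∈) zero)))
        where
        e∈ = here refl
        f∈ = there (there (H.edgeAt-∈ q′ zero))

    minor-size : size H ≤ order H * k ^ suc t
    minor-size = begin
      size H ≡⟨ sym (length-tabulate {n = size H} (λ e → e)) ⟩
      length (allFin (size H)) ≡⟨ sym (∑-one (allFin (size H))) ⟩
      ∑ (allFin (size H)) (λ _ → 1) ≤⟨ ∑-mono (allFin (size H))
          (λ e _ → ≤-trans (1≤⟦⟧ (code e Fin.≟ code e) refl)
        (∈⇒≤∑ (λ a → ⟦ code e Fin.≟ a ⟧) (∈-allFin (code e)))) ⟩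
      ∑ (allFin (size H)) (λ e → ∑ (allFin (k ^ suc t)) (λ a → ⟦ code e Fin.≟ a ⟧))
        ≡⟨ ∑-swap (allFin (size H)) (allFin (k ^ suc t)) (λ e a → ⟦ code e Fin.≟ a ⟧) ⟩
      ∑ (allFin (k ^ suc t)) (λ a → ∑ (allFin (size H)) (λ e → ⟦ code e Fin.≟ a ⟧))
        ≤⟨ ∑-≤-const (allFin (k ^ suc t)) (λ a _ → ≤-trans
            (≤-reflexive (sym (length-filter-∑ (λ e → code e Fin.≟ a) (allFin (size H)))))
             (forest-size (code-class a) (Unique.filter⁺ _ (Unique.allFin⁺ (size H)))
                 (class-acyclic a))) ⟩
      length (allFin (k ^ suc t)) * order H ≡⟨ cong (_* order H)
          (length-tabulate {n = k ^ suc t} (λ a → a)) ⟩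
      k ^ suc t * order H ≡⟨ *-comm (k ^ suc t) (order H) ⟩
      order H * k ^ suc t ∎
      where open ≤-Reasoning

  -- The inequality between the root of the density and `Arb`, raised to the power `p`; both sides
  -- are nonnegative, so nothing is lost. Only the minor that attains the maximum has to be
  -- examined.
  grad≤Arb^ : ∀ t G → ∇̃ᵐ t G ℚ.≤ ι (Arb (suc t) G ^ suc t)
  grad≤Arb^ t G with H , (s , s≤t , φ) , eq ← IsTopGrad.attained (∇̃ᵐ-isTopGrad t G)
    with c , arb ← IsArb.colourable (Arb-isArb (suc t) G) =
    subst (ℚ._≤ ι (Arb (suc t) G ^ suc t)) eq
      (ratio≤ (order H) (size H) (Arb (suc t) G ^ suc t)
          (LowerBound.minor-size G {c = c} arb H s s≤t φ))

  arbPoly : ℕ → Polynomial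
  arbPoly t = powerPoly factor exponent
    where open PolyBounded (poly-colourBound t)

  -- The integer `suc k` is used from both sides: it bounds the density of every shallow minor, and
  -- it is at most one plus the largest density, which turns a bound polynomial in `suc k` into one
  -- in the density.
  Arb≤eval : ∀ t G → ι (Arb (suc t) G) ℚ.≤ eval (arbPoly t) (∇̃ᵐ t G)
  Arb≤eval t G with H , _ , eq ← IsTopGrad.attained (∇̃ᵐ-isTopGrad t G)
    with k , q≤k , k≤1+q ← ratio-ceiling (order H) (size H) = ℚ.≤-trans
      (ι-mono (≤-trans (IsArb.minimal (Arb-isArb (suc t) G) _ (arb-colourable G sparse))
          (bounded k)))
      (power≤eval factor exponent (suc k) {∇̃ᵐ t G} (subst (λ q → ι (suc k) ℚ.≤ 1ℚ ℚ.+ q) eq k≤1+q))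
    where
    open PolyBounded (poly-colourBound t)
    sparse : Arcs.Sparse G t (suc k)
    sparse H′ minor = ≤ratio H′ (suc k) (ℚ.≤-trans (IsTopGrad.bound (∇̃ᵐ-isTopGrad t G) H′ minor)
      (subst (ℚ._≤ ι (suc k)) eq q≤k))

open Arboricity
open import Data.Integer using (+_)
open import Data.Nat using (ℕ; suc; NonZero; _∸_; _^_)
open import Data.Product using (_,_; Σ-syntax; _×_)
open import Data.Rational using (_/_; _≤_)

mainTheorem15 : (p : ℕ) → .{{_ : NonZero p}} →
    Σ[ P ∈ Polynomial ] ((G : Multigraph) →
    (∇̃ᵐ (p ∸ 1) G ≤ + (Arb p G ^ p) / 1) ×
    (+ Arb p G / 1 ≤ eval P (∇̃ᵐ (p ∸ 1) G)))
mainTheorem15 (suc t) = arbPoly t , λ G → grad≤Arb^ t G , Arb≤eval t G
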